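{- Let $P\subseteq\mathbb{R}^d$ be a $d$-polytope and let $\mathcal{C}$ be a set of (nonempty) faces of $P$. Then the identity $\prod_{F\in\mathcal{C}}([P]-[F])=0$ holds in the Minkowski ring of $P$ and its faces if and only if $\mathcal{C}$ covers all the vertices of $P$, i.e. every vertex of $P$ lies in some $F\in\mathcal{C}$.
   Context: For $S\subseteq W=\mathbb{R}^d$, $[S]:W\to\mathbb{C}$ denotes its indicator function. $M(\mathcal{P}(W))$ is the complex vector space of functions on $W$ spanned by indicator functions of closed convex polyhedra, a commutative $\mathbb{C}$-algebra with the well-defined bilinear product determined by $[A]\cdot[B]=[A+B]$ (Minkowski sum) for nonempty closed convex polyhedra, with unit $[\{0\}]$. The Minkowski face ring $M(\mathcal{F}(P))$ is the unital $\mathbb{C}$-subalgebra generated by the indicator functions of the nonempty closed faces of $P$, including $P$ itself. The product in the claim is the product in this ring. -}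

module Defs where

open import Level using (0ℓ) renaming (suc to lsuc)
open import Algebra.Bundles using (CommutativeRing; RawRing)
open import Axiom.ExcludedMiddle using (ExcludedMiddle)
open import Data.Fin.Base using (Fin; zero; suc)
open import Data.List.Base as List using (List; []; _∷_; _++_; cartesianProductWith)
open import Data.List.Relation.Unary.All as All using (All; []; _∷_)
import Data.List.Relation.Unary.All.Properties as All
import Data.List.Relation.Unary.Unique.Setoid as UniqueSetoid
open import Data.Nat.Base using (ℕ; zero; suc) renaming (_+_ to _ℕ+_)
open import Data.Product.Base as Product using (Σ; ∃; ∃₂; _×_; _,_; proj₁; proj₂)
open import Data.Sum.Base using (_⊎_; inj₁; inj₂)
open import Data.Vec.Functional as Vector using (Vector; head; tail)
open import Function.Base using (_∘_)
open import Function.Bundles using (_⇔_; mk⇔; module Equivalence)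
open import Relation.Binary.Bundles using (Setoid)
open import Relation.Binary.Core using (Rel)
import Relation.Binary.Construct.On as On
open import Relation.Binary.Structures using (IsTotalOrder)
open import Relation.Nullary using (¬_; Dec; yes; no; contradiction)
open import Relation.Unary using (Pred; _∈_; _⊆_; _≐_; _∩_; Satisfiable)
open import Relation.Unary.Properties using (≐-trans)
open import Relation.Unary.Relation.Binary.Equality using (≐-setoid)

-- The real numbers, axiomatised up to isomorphism as a Dedekind complete
-- ordered field.  Classically ℝ is, up to isomorphism, the only model.
record CompleteOrderedField : Set₁ where
  field
    commutativeRing : CommutativeRing 0ℓ 0ℓ
  open CommutativeRing commutativeRing public
  infix 4 _≤_
  field
    _≤_          : Rel Carrier 0ℓ
    isTotalOrder : IsTotalOrder _≈_ _≤_
    0≉1          : ¬ (0# ≈ 1#)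
    inverse      : ∀ x → ¬ (x ≈ 0#) → ∃ λ y → x * y ≈ 1#
    +-monoˡ-≤    : ∀ z {x y} → x ≤ y → x + z ≤ y + z
    *-nonneg     : ∀ {x y} → 0# ≤ x → 0# ≤ y → 0# ≤ x * y
  UpperBound : Pred Carrier 0ℓ → Pred Carrier 0ℓ
  UpperBound S b = ∀ {x} → x ∈ S → x ≤ b
  field
    complete : (S : Pred Carrier 0ℓ) → Satisfiable S → Satisfiable (UpperBound S) →
               ∃ λ s → UpperBound S s × (∀ {b} → UpperBound S b → s ≤ b)

module ConvexGeometry (lem : ∀ {ℓ} → ExcludedMiddle ℓ) (ℝ : CompleteOrderedField) where

  open CompleteOrderedField ℝ hiding (zero; _-_)
  open IsTotalOrder isTotalOrder using (total; antisym)
    renaming (trans to ≤-trans; reflexive to ≤-reflexive; ≤-respˡ-≈ to ≤-respˡ; ≤-respʳ-≈ to ≤-respʳ)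
  open import Algebra.Properties.Ring ring
    using (-‿distribˡ-*; -‿distribʳ-*; -‿involutive; -0#≈0#; -1*x≈-x)
  open import Algebra.Properties.Semiring.Sum semiring
    using (sum; sum-cong-≋; ∑-distrib-+; *-distribˡ-sum)
  open import Algebra.Solver.Ring.NaturalCoefficients.Default commutativeSemiring
    using (solve; _:=_; _:+_; _:*_)

  private variable
    d k m n : ℕ

  W : ℕ → Set
  W d = Vector Carrier d

  Subset : ℕ → Set₁
  Subset d = Pred (W d) 0ℓ

  infix 4 _≋_
  _≋_ : Rel (W d) 0ℓ
  x ≋ y = ∀ i → x i ≈ y i

  infixl 6 _+ᵛ_
  _+ᵛ_ : W d → W d → W d
  (x +ᵛ y) i = x i + y i

  0ᵛ : W d
  0ᵛ _ = 0#

  infixl 7 _*ᵛ_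
  _*ᵛ_ : Carrier → W d → W d
  (c *ᵛ x) i = c * x i

  -ᵛ_ : W d → W d
  (-ᵛ x) i = - x i

  infix 7 _·_
  _·_ : W d → W d → Carrier
  a · x = sum λ i → a i * x i

  combination : Vector Carrier n → Vector (W d) n → W d
  combination c p j = sum λ i → c i * p i j

  ｛_｝ : W d → Subset d
  ｛ v ｝ x = x ≋ v

  infixl 6 _⊕_
  _⊕_ : Subset d → Subset d → Subset d
  (A ⊕ B) z = ∃₂ λ x y → x ∈ A × y ∈ B × z ≋ x +ᵛ y

  -- (a , b) stands for the closed half-space of all x with a · x ≤ b.
  HalfSpace : ℕ → Set
  HalfSpace d = W d × Carrier

  infix 4 _∈ᴴ_
  _∈ᴴ_ : W d → HalfSpace d → Set
  x ∈ᴴ (a , b) = a · x ≤ b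

  Intersection : List (HalfSpace d) → Subset d
  Intersection hs x = All (x ∈ᴴ_) hs

  IsPolyhedron : Subset d → Set
  IsPolyhedron S = ∃ λ hs → S ≐ Intersection hs

  conv : Vector (W d) n → Subset d
  conv p x = ∃ λ c → (∀ i → 0# ≤ c i) × sum c ≈ 1# × x ≋ combination c p

  aff : Vector (W d) n → Subset d
  aff p x = ∃ λ c → sum c ≈ 1# × x ≋ combination c p

  AffinelyIndependent : Vector (W d) n → Set
  AffinelyIndependent p = ∀ c → sum c ≈ 0# → combination c p ≋ 0ᵛ → ∀ i → c i ≈ 0#

  -- The affine hull of S is spanned by k + 1 affinely independent points of S;
  -- the empty set has no dimension in this sense.
  HasDimension : ℕ → Subset d → Set
  HasDimension {d} k S = ∃ λ (p : Vector (W d) (suc k)) →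
    (∀ i → p i ∈ S) × AffinelyIndependent p × S ⊆ aff p

  record Polytope (k d : ℕ) : Set₁ where
    field
      set       : Subset d
      size      : ℕ
      points    : Vector (W d) size
      set≐conv  : set ≐ conv points
      dimension : HasDimension k set

    nonempty : Satisfiable set
    nonempty = let p , p∈set , _ = dimension in p zero , p∈set zero

  -- Nonempty faces: the sets on which a linear functional bounded by b on S
  -- attains the value b.  The zero functional gives S itself.
  IsFace : Subset d → Subset d → Set
  IsFace S F = Satisfiable F × ∃₂ λ a b →
    (∀ {x} → x ∈ S → a · x ≤ b) × F ≐ (S ∩ λ x → a · x ≈ b)

  IsVertex : Subset d → W d → Set
  IsVertex S v = IsFace S ｛ v ｝

  record Face (P : Polytope k d) : Set₁ where
    field
      set    : Subset d
      isFace : IsFace (Polytope.set P) set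

    nonempty : Satisfiable set
    nonempty = proj₁ isFace

  faceSetoid : Polytope k d → Setoid (lsuc 0ℓ) 0ℓ
  faceSetoid {d = d} P = On.setoid (≐-setoid (W d) 0ℓ) (Face.set {P = P})

  module _ (P : Polytope k d) where
    open UniqueSetoid (faceSetoid P) public using () renaming (Unique to UniqueFaces)

  ------------------------------------------------------------------------
  -- Polyhedra are closed under linear projection (Fourier–Motzkin), hence
  -- under Minkowski sum; polytopes and their faces are polyhedra

  module FourierMotzkin where
    ≤-refl : ∀ {x} → x ≤ x
    ≤-refl = ≤-reflexive refl

    +-mono-≤ : ∀ {x y u v} → x ≤ y → u ≤ v → x + u ≤ y + v
    +-mono-≤ {x} {y} {u} {v} p q = ≤-trans (+-monoˡ-≤ u p)
      (≤-respˡ (+-comm u y) (≤-respʳ (+-comm v y) (+-monoˡ-≤ y q)))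

    cancel : ∀ x z → (x + z) + - z ≈ x
    cancel x z = trans (+-assoc x z (- z)) (trans (+-congˡ (-‿inverseʳ z)) (+-identityʳ x))

    cancel′ : ∀ x z → (x + - z) + z ≈ x
    cancel′ x z = trans (+-assoc x (- z) z) (trans (+-congˡ (-‿inverseˡ z)) (+-identityʳ x))

    +-cancelʳ-≤ : ∀ z {x y} → x + z ≤ y + z → x ≤ y
    +-cancelʳ-≤ z p = ≤-respˡ (cancel _ z) (≤-respʳ (cancel _ z) (+-monoˡ-≤ (- z) p))

    neg-≤ : ∀ {x y} → x ≤ y → - y ≤ - x
    neg-≤ {x} {y} p = +-cancelʳ-≤ (x + y)
      (≤-respˡ (sym l) (≤-respʳ (sym r) p))
      where
      l : - y + (x + y) ≈ x
      l = trans (+-comm _ _) (cancel x y)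
      r : - x + (x + y) ≈ y
      r = trans (+-comm _ _) (trans (+-congʳ (+-comm x y)) (cancel y x))

    0≤- : ∀ {x} → x ≤ 0# → 0# ≤ - x
    0≤- p = ≤-respˡ -0#≈0# (neg-≤ p)

    0≤-⁻¹ : ∀ {x} → 0# ≤ - x → x ≤ 0#
    0≤-⁻¹ p = ≤-respˡ (-‿involutive _) (≤-respʳ -0#≈0# (neg-≤ p))

    diff : ∀ {x y} → x ≤ y → 0# ≤ y + - x
    diff {x} p = ≤-respˡ (-‿inverseʳ x) (+-monoˡ-≤ (- x) p)

    *-monoˡ-≤ : ∀ {c x y} → 0# ≤ c → x ≤ y → c * x ≤ c * y
    *-monoˡ-≤ {c} {x} {y} 0≤c p = ≤-respˡ (+-identityˡ _) (≤-respʳ eq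
      (+-monoˡ-≤ (c * x) (*-nonneg 0≤c (diff p))))
      where
      eq : c * (y + - x) + c * x ≈ c * y
      eq = trans (sym (distribˡ c _ _)) (*-congˡ (cancel′ y x))

    0≤1 : 0# ≤ 1#
    0≤1 with total 0# 1#
    ... | inj₁ p = p
    ... | inj₂ p = ≤-respʳ (trans (-1*x≈-x (- 1#)) (-‿involutive 1#)) (*-nonneg (0≤- p) (0≤- p))

    positiveInverse : ∀ {c} → 0# ≤ c → ¬ (c ≈ 0#) → ∃ λ k → 0# ≤ k × k * c ≈ 1#
    positiveInverse {c} 0≤c c≉0 with inverse c c≉0
    ... | k , ck≈1 with total 0# k
    ...   | inj₁ 0≤k = k , 0≤k , trans (*-comm k c) ck≈1
    ...   | inj₂ k≤0 = contradiction (antisym 0≤1 1≤0) 0≉1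
      where
      1≤0 : 1# ≤ 0#
      1≤0 = 0≤-⁻¹ (≤-respʳ (trans (sym (-‿distribʳ-* c k)) (-‿cong ck≈1)) (*-nonneg 0≤c (0≤- k≤0)))

    ·-congˡ : ∀ (a : W d) {x y} → x ≋ y → a · x ≈ a · y
    ·-congˡ a p = sum-cong-≋ (λ i → *-congˡ (p i))

    ·-congʳ : ∀ {a b : W d} x → a ≋ b → a · x ≈ b · x
    ·-congʳ x p = sum-cong-≋ (λ i → *-congʳ (p i))

    ·-distribʳ : ∀ (a b x : W d) → (a +ᵛ b) · x ≈ a · x + b · x
    ·-distribʳ a b x = trans (sum-cong-≋ (λ i → distribʳ (x i) (a i) (b i))) (∑-distrib-+ (λ i → a i * x i) (λ i → b i * x i))

    ·-distribˡ : ∀ (a x y : W d) → a · (x +ᵛ y) ≈ a · x + a · y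
    ·-distribˡ a x y = trans (sum-cong-≋ (λ i → distribˡ (a i) (x i) (y i))) (∑-distrib-+ (λ i → a i * x i) (λ i → a i * y i))

    ·-scale : ∀ c (a x : W d) → (c *ᵛ a) · x ≈ c * (a · x)
    ·-scale c a x = trans (sum-cong-≋ (λ i → *-assoc c (a i) (x i)))
      (sym (*-distribˡ-sum c (λ i → a i * x i)))

    ·-neg : ∀ (a x : W d) → (-ᵛ a) · x ≈ - (a · x)
    ·-neg a x = trans (·-congʳ x (λ i → sym (-1*x≈-x (a i)))) (trans (·-scale (- 1#) a x) (-1*x≈-x _))

    ·-zero : ∀ (x : W d) → 0ᵛ · x ≈ 0#
    ·-zero x = trans (·-congʳ x (λ _ → sym (zeroˡ 0#))) (trans (·-scale 0# 0ᵛ x) (zeroˡ _))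

    -- Recursive, so that, unlike Data.Vec.Functional._++_, it computes on the head.
    _++ᵛ_ : W m → W n → W (m ℕ+ n)
    _++ᵛ_ {zero}  y x = x
    _++ᵛ_ {suc m} y x = head y Vector.∷ (tail y ++ᵛ x)

    ·-++ : ∀ (a y : W m) (a′ x : W n) → (a ++ᵛ a′) · (y ++ᵛ x) ≈ a · y + a′ · x
    ·-++ {zero}  a y a′ x = sym (+-identityˡ _)
    ·-++ {suc m} a y a′ x = trans (+-congˡ (·-++ (tail a) (tail y) a′ x)) (sym (+-assoc _ _ _))

    unit : Fin d → W d
    unit zero    = 1# Vector.∷ 0ᵛ
    unit (suc i) = 0# Vector.∷ unit i

    ·-unit : ∀ (i : Fin d) x → unit i · x ≈ x i
    ·-unit zero    x = trans (+-cong (*-identityˡ _) (·-zero (tail x))) (+-identityʳ _)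
    ·-unit (suc i) x = trans (+-cong (zeroˡ _) (·-unit i (tail x))) (+-identityˡ _)

    -- The conditions imposed on a head coordinate t by a system of half-spaces.
    record Bounds (hs : List (HalfSpace (suc n))) : Set where
      field
        free upper lower : List (HalfSpace n)
        spec : ∀ t x → All ((t Vector.∷ x) ∈ᴴ_) hs ⇔
          (Intersection free x ×
           All (λ (a , b) → a · x + t ≤ b) upper ×
           All (λ (a , b) → a · x ≤ b + t) lower)

    scaled : ∀ {k c x x′ y y′} → 0# ≤ k → 0# ≤ c → k * c ≈ 1# →
             k * x ≈ x′ → k * y ≈ y′ → x ≤ y ⇔ x′ ≤ y′
    scaled {k} {c} {x} {x′} {y} {y′} 0≤k 0≤c kc≈1 p q = mk⇔
      (λ r → ≤-respˡ p (≤-respʳ q (*-monoˡ-≤ 0≤k r)))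
      (λ r → ≤-respˡ (back p) (≤-respʳ (back q) (*-monoˡ-≤ 0≤c r)))
      where
      back : ∀ {z z′} → k * z ≈ z′ → c * z′ ≈ z
      back {z} {z′} e = trans (*-congˡ (sym e)) (trans (sym (*-assoc c k z))
        (trans (*-congʳ (trans (*-comm c k) kc≈1)) (*-identityˡ z)))

    bounds : (hs : List (HalfSpace (suc n))) → Bounds hs
    bounds [] = record
      { free = [] ; upper = [] ; lower = []
      ; spec = λ t x → mk⇔ (λ _ → [] , [] , []) (λ _ → []) }
    bounds {n} ((a , b) ∷ hs) = go (lem {P = head a ≈ 0#}) (total 0# (head a))
      where
      module B = Bounds (bounds hs)
      module S t x = Equivalence (B.spec t x)

      go : Dec (head a ≈ 0#) → 0# ≤ head a ⊎ head a ≤ 0# → Bounds ((a , b) ∷ hs)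
      go (yes c≈0) _ = record
        { free = (tail a , b) ∷ B.free ; upper = B.upper ; lower = B.lower
        ; spec = λ t x → mk⇔
            (λ { (p ∷ ps) → let f , u , l = S.to t x ps in (≤-respˡ (eq t x) p ∷ f) , u , l })
            (λ { (p ∷ f , u , l) → ≤-respˡ (sym (eq t x)) p ∷ S.from t x (f , u , l) }) }
        where
        eq : ∀ t x → head a * t + tail a · x ≈ tail a · x
        eq t x = trans (+-congʳ (trans (*-congʳ c≈0) (zeroˡ t))) (+-identityˡ _)
      go (no c≉0) (inj₁ 0≤c) = record
        { free = B.free ; upper = (κ *ᵛ tail a , κ * b) ∷ B.upper ; lower = B.lower
        ; spec = λ t x → mk⇔
            (λ { (p ∷ ps) → let f , u , l = S.to t x ps in f , (E.to t x p ∷ u) , l })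
            (λ { (f , p ∷ u , l) → E.from t x p ∷ S.from t x (f , u , l) }) }
        where
        inv = positiveInverse 0≤c c≉0
        κ = proj₁ inv
        eq : ∀ t x → κ * (head a * t + tail a · x) ≈ (κ *ᵛ tail a) · x + t
        eq t x = trans
          (solve 4 (λ κ c t s → κ :* (c :* t :+ s) := κ :* s :+ (κ :* c) :* t) refl κ (head a) t (tail a · x))
          (+-cong (sym (·-scale κ (tail a) x)) (trans (*-congʳ (proj₂ (proj₂ inv))) (*-identityˡ t)))
        module E t x = Equivalence (scaled (proj₁ (proj₂ inv)) 0≤c (proj₂ (proj₂ inv)) (eq t x) (refl {κ * b}))
      go (no c≉0) (inj₂ c≤0) = record
        { free = B.free ; upper = B.upper ; lower = (κ *ᵛ tail a , κ * b) ∷ B.lower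
        ; spec = λ t x → mk⇔
            (λ { (p ∷ ps) → let f , u , l = S.to t x ps in f , u , (E.to t x (forth t p) ∷ l) })
            (λ { (f , u , p ∷ l) → back t (E.from t x p) ∷ S.from t x (f , u , l) }) }
        where
        c = head a
        inv = positiveInverse (0≤- c≤0) (λ e → c≉0 (trans (sym (-‿involutive c)) (trans (-‿cong e) -0#≈0#)))
        κ = proj₁ inv
        shift : ∀ t s → (c * t + s) + - c * t ≈ s
        shift t s = trans (+-congʳ (+-comm _ s)) (trans (+-congˡ (sym (-‿distribˡ-* c t))) (cancel s (c * t)))
        forth : ∀ t {s} → c * t + s ≤ b → s ≤ b + - c * t
        forth t p = ≤-respˡ (shift t _) (+-monoˡ-≤ (- c * t) p)
        back : ∀ t {s} → s ≤ b + - c * t → c * t + s ≤ b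
        back t p = +-cancelʳ-≤ (- c * t) (≤-respˡ (sym (shift t _)) p)
        eq : ∀ t → κ * (b + - c * t) ≈ κ * b + t
        eq t = trans (distribˡ κ _ _) (+-congˡ (trans (sym (*-assoc κ (- c) t))
          (trans (*-congʳ (proj₂ (proj₂ inv))) (*-identityˡ t))))
        module E t x = Equivalence (scaled {x = tail a · x} (proj₁ (proj₂ inv)) (0≤- c≤0) (proj₂ (proj₂ inv))
          (sym (·-scale κ (tail a) x)) (eq t))

    between : (ls us : List Carrier) → All (λ l → All (l ≤_) us) ls →
              ∃ λ t → All (_≤ t) ls × All (t ≤_) us
    between [] [] _ = 0# , [] , []
    between [] (u ∷ us) _ with between [] us []
    ... | t , _ , t≤us with total t u
    ...   | inj₁ t≤u = t , [] , t≤u ∷ t≤us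
    ...   | inj₂ u≤t = u , [] , ≤-refl ∷ All.map (≤-trans u≤t) t≤us
    between (l ∷ ls) us (l≤us ∷ ls≤us) with between ls us ls≤us
    ... | t , ls≤t , t≤us with total l t
    ...   | inj₁ l≤t = t , l≤t ∷ ls≤t , t≤us
    ...   | inj₂ t≤l = l , ≤-refl ∷ All.map (λ p → ≤-trans p t≤l) ls≤t , l≤us

    pair : HalfSpace n → HalfSpace n → HalfSpace n
    pair (a , b) (a′ , b′) = a +ᵛ a′ , b + b′

    pairs⁺ : ∀ {us ls : List (HalfSpace n)} {x t} →
             All (λ (a , b) → a · x + t ≤ b) us → All (λ (a , b) → a · x ≤ b + t) ls →
             Intersection (cartesianProductWith pair us ls) x
    pairs⁺ [] ls = []
    pairs⁺ {us = (a , b) ∷ _} {x = x} {t} (u ∷ us) ls = All.++⁺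
      (All.map⁺ (All.map (λ {h} → one {proj₁ h} {proj₂ h}) ls)) (pairs⁺ us ls)
      where
      one : ∀ {a′ b′} → a′ · x ≤ b′ + t → (a +ᵛ a′) · x ≤ b + b′
      one {a′} {b′} l = +-cancelʳ-≤ t (≤-respˡ eq₁ (≤-respʳ (sym (+-assoc b b′ t)) (+-mono-≤ u l)))
        where
        eq₁ : (a · x + t) + a′ · x ≈ (a +ᵛ a′) · x + t
        eq₁ = trans (solve 3 (λ p t q → (p :+ t) :+ q := (p :+ q) :+ t) refl (a · x) t (a′ · x))
          (+-congʳ (sym (·-distribʳ a a′ x)))

    pairs⁻ : ∀ (us ls : List (HalfSpace n)) {x} →
             Intersection (cartesianProductWith pair us ls) x →
             All (λ (a , b) → All (λ (a′ , b′) → a′ · x + - b′ ≤ b + - (a · x)) ls) us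
    pairs⁻ [] ls _ = []
    pairs⁻ ((a , b) ∷ us) ls {x} ps =
      All.map (λ {h} → one {proj₁ h} {proj₂ h}) (All.map⁻ (All.++⁻ˡ (List.map (pair (a , b)) ls) ps))
        ∷ pairs⁻ us ls (All.++⁻ʳ (List.map (pair (a , b)) ls) ps)
      where
      one : ∀ {a′ b′} → (a +ᵛ a′) · x ≤ b + b′ → a′ · x + - b′ ≤ b + - (a · x)
      one {a′} {b′} p = +-cancelʳ-≤ (a · x + b′) (≤-respˡ eq₁ (≤-respʳ eq₂ p))
        where
        eq₁ : (a +ᵛ a′) · x ≈ (a′ · x + - b′) + (a · x + b′)
        eq₁ = trans (·-distribʳ a a′ x) (trans (sym (cancel′ _ b′))
          (solve 4 (λ p q m b → ((p :+ q) :+ m) :+ b := (q :+ m) :+ (p :+ b)) refl (a · x) (a′ · x) (- b′) b′))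
        eq₂ : b + b′ ≈ (b + - (a · x)) + (a · x + b′)
        eq₂ = trans (+-congʳ (sym (cancel′ b (a · x)))) (+-assoc _ _ _)

    eliminate : (hs : List (HalfSpace (suc n))) →
                ∃ λ hs′ → ∀ x → Intersection hs′ x ⇔ (∃ λ t → Intersection hs (t Vector.∷ x))
    eliminate hs = B.free ++ cartesianProductWith pair B.upper B.lower , λ x → mk⇔ (to x) (from x)
      where
      module B = Bounds (bounds hs)
      from : ∀ x → (∃ λ t → Intersection hs (t Vector.∷ x)) → _
      from x (t , p) = let f , u , l = Equivalence.to (B.spec t x) p in All.++⁺ f (pairs⁺ u l)
      swap : ∀ {A B : Set} {R : A → B → Set} {xs : List A} {ys : List B} →
             All (λ x → All (R x) ys) xs → All (λ y → All (λ x → R x y) xs) ys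
      swap {ys = []}     ps = []
      swap {ys = y ∷ ys} ps = All.map All.head ps ∷ swap (All.map All.tail ps)
      to : ∀ x → Intersection (B.free ++ cartesianProductWith pair B.upper B.lower) x → _
      to x p = t , Equivalence.from (B.spec t x)
        ( All.++⁻ˡ B.free p
        , All.map (λ {h} → upper {proj₁ h} {proj₂ h}) (All.map⁻ t≤us)
        , All.map (λ {h} → lower {proj₁ h} {proj₂ h}) (All.map⁻ ls≤t))
        where
        lo up : HalfSpace _ → Carrier
        lo (a , b) = a · x + - b
        up (a , b) = b + - (a · x)
        found = between (List.map lo B.lower) (List.map up B.upper)
          (All.map⁺ (All.map All.map⁺ (swap {R = λ u l → lo l ≤ up u} (pairs⁻ B.upper B.lower (All.++⁻ʳ B.free p)))))
        t = proj₁ found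
        ls≤t = proj₁ (proj₂ found)
        t≤us = proj₂ (proj₂ found)
        upper : ∀ {a b} → t ≤ b + - (a · x) → a · x + t ≤ b
        upper {a} {b} q = ≤-respˡ (+-comm t _) (≤-respʳ (cancel′ b (a · x)) (+-monoˡ-≤ (a · x) q))
        lower : ∀ {a b} → a · x + - b ≤ t → a · x ≤ b + t
        lower {a} {b} q = ≤-respˡ (cancel′ (a · x) b) (≤-respʳ (+-comm t b) (+-monoˡ-≤ b q))

    project : ∀ m (hs : List (HalfSpace (m ℕ+ n))) →
              ∃ λ hs′ → ∀ x → Intersection hs′ x ⇔ (∃ λ (y : W m) → Intersection hs (y ++ᵛ x))
    project zero    hs = hs , λ x → mk⇔ (λ p → (λ ()) , p) proj₂
    project (suc m) hs = hs″ , λ x → mk⇔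
      (λ p → let y , q = Equivalence.to (eqv′ x) p
                 t , r = Equivalence.to (eqv (y ++ᵛ x)) q
             in (t Vector.∷ y) , r)
      (λ (y , r) → Equivalence.from (eqv′ x) (tail y , Equivalence.from (eqv (tail y ++ᵛ x)) (head y , r)))
      where
      hs′ = proj₁ (eliminate hs)
      eqv = proj₂ (eliminate hs)
      hs″ = proj₁ (project m hs′)
      eqv′ = proj₂ (project m hs′)

    -- The half-spaces a · x ≤ b and a · x ≥ b.
    equation : W d → Carrier → List (HalfSpace d)
    equation a b = (a , b) ∷ (-ᵛ a , - b) ∷ []

    equation⁺ : ∀ {a x : W d} {b} → a · x ≈ b → Intersection (equation a b) x
    equation⁺ {a = a} {x} p = ≤-reflexive p ∷ ≤-reflexive (trans (·-neg a x) (-‿cong p)) ∷ []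

    equation⁻ : ∀ {a x : W d} {b} → Intersection (equation a b) x → a · x ≈ b
    equation⁻ {a = a} {x} {b} (p ∷ q ∷ []) = antisym p
      (≤-respˡ (-‿involutive b) (≤-respʳ (-‿involutive _) (neg-≤ (≤-respˡ (·-neg a x) q))))

    equations : Vector (W d × Carrier) n → List (HalfSpace d)
    equations e = List.concat (List.tabulate (λ i → equation (proj₁ (e i)) (proj₂ (e i))))

    equations⁺ : ∀ (e : Vector (W d × Carrier) n) {x} →
                 (∀ i → proj₁ (e i) · x ≈ proj₂ (e i)) → Intersection (equations e) x
    equations⁺ e p = All.concat⁺ (All.tabulate⁺ (λ i → equation⁺ (p i)))

    equations⁻ : ∀ (e : Vector (W d × Carrier) n) {x} →
                 Intersection (equations e) x → ∀ i → proj₁ (e i) · x ≈ proj₂ (e i)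
    equations⁻ e p i = equation⁻ (All.tabulate⁻ (All.concat⁻ p) i)

    projection : ∀ m {S : Subset d} (hs : List (HalfSpace (m ℕ+ d))) →
                 (∀ {x} → x ∈ S → ∃ λ y → Intersection hs (y ++ᵛ x)) →
                 (∀ {x} y → Intersection hs (y ++ᵛ x) → x ∈ S) → IsPolyhedron S
    projection m hs to from = proj₁ (project m hs) ,
      (λ {x} s → Equivalence.from (proj₂ (project m hs) x) (to s)) ,
      (λ {x} p → let y , q = Equivalence.to (proj₂ (project m hs) x) p in from y q)

    ≐-polyhedron : ∀ {S T : Subset d} → S ≐ T → IsPolyhedron T → IsPolyhedron S
    ≐-polyhedron S≐T (hs , T≐hs) = hs , ≐-trans S≐T T≐hs

  open FourierMotzkin

  respects : ∀ {S : Subset d} → IsPolyhedron S → ∀ {x y} → x ≋ y → x ∈ S → y ∈ S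
  respects (hs , S⊆hs , hs⊆S) x≋y x∈S =
    hs⊆S (All.map (λ {h} → ≤-respˡ (·-congˡ (proj₁ h) x≋y)) (S⊆hs x∈S))

  point-polyhedron : (v : W d) → IsPolyhedron ｛ v ｝
  point-polyhedron v = equations e ,
    (λ {x} x≋v → equations⁺ e (λ i → trans (·-unit i x) (x≋v i))) ,
    (λ {x} p i → trans (sym (·-unit i x)) (equations⁻ e p i))
    where
    e = λ i → unit i , v i

  ∩-hyperplane-polyhedron : ∀ {S : Subset d} a b → IsPolyhedron S → IsPolyhedron (S ∩ λ x → a · x ≈ b)
  ∩-hyperplane-polyhedron a b (hs , S⊆hs , hs⊆S) = equation a b ++ hs ,
    (λ (x∈S , p) → All.++⁺ (equation⁺ p) (S⊆hs x∈S)) ,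
    (λ p → hs⊆S (All.++⁻ʳ (equation a b) p) , equation⁻ (All.++⁻ˡ (equation a b) p))

  ⊕-polyhedron : ∀ {A B : Subset d} → IsPolyhedron A → IsPolyhedron B → IsPolyhedron (A ⊕ B)
  ⊕-polyhedron {d} {A} {B} isA@(as , A⊆as , as⊆A) isB@(bs , B⊆bs , bs⊆B) =
    projection d (List.map left as ++ List.map right bs)
      (λ {z} (x , y , x∈A , y∈B , z≋x+y) → x , All.++⁺
        (All.map⁺ (All.map (λ {h} → ≤-respˡ (sym (eqˡ (proj₁ h) x z))) (A⊆as x∈A)))
        (All.map⁺ (All.map (λ {h} → ≤-respˡ (sym (trans (eqʳ (proj₁ h) x z)
          (·-congˡ (proj₁ h) (λ i → trans (+-congʳ (trans (z≋x+y i) (+-comm _ _))) (cancel (y i) (x i)))))))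
          (B⊆bs y∈B))))
      (λ {z} x p → x , z +ᵛ (-ᵛ x) ,
        as⊆A (All.map (λ {h} → ≤-respˡ (eqˡ (proj₁ h) x z)) (All.map⁻ (All.++⁻ˡ (List.map left as) p))) ,
        bs⊆B (All.map (λ {h} → ≤-respˡ (eqʳ (proj₁ h) x z)) (All.map⁻ (All.++⁻ʳ (List.map left as) p))) ,
        (λ i → sym (trans (+-comm _ _) (cancel′ (z i) (x i)))))
    where
    left right : HalfSpace d → HalfSpace (d ℕ+ d)
    left  (a , b) = a ++ᵛ 0ᵛ , b
    right (a , b) = (-ᵛ a) ++ᵛ a , b
    eqˡ : ∀ a x z → (a ++ᵛ 0ᵛ) · (x ++ᵛ z) ≈ a · x
    eqˡ a x z = trans (·-++ a x 0ᵛ z) (trans (+-congˡ (·-zero z)) (+-identityʳ _))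
    eqʳ : ∀ a x z → ((-ᵛ a) ++ᵛ a) · (x ++ᵛ z) ≈ a · (z +ᵛ (-ᵛ x))
    eqʳ a x z = trans (·-++ (-ᵛ a) x a z) (trans (+-comm _ _) (trans
      (+-congˡ (sum-cong-≋ (λ i → trans (sym (-‿distribˡ-* (a i) (x i))) (-‿distribʳ-* (a i) (x i)))))
      (sym (·-distribˡ a z (-ᵛ x)))))

  conv-polyhedron : (p : Vector (W d) n) → IsPolyhedron (conv p)
  conv-polyhedron {d} {n} p = projection n system
    (λ {x} (c , 0≤c , Σc≈1 , x≋cp) → c , All.++⁺
      (All.tabulate⁺ (λ i → ≤-respˡ (sym (eq₁ i c x)) (≤-respʳ -0#≈0# (neg-≤ (0≤c i)))))
      (equation⁺ (trans (eq₂ c x) Σc≈1) ⊹⊹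
       equations⁺ coords (λ j → trans (eq₃ j c x) (trans (+-congʳ (-‿cong (x≋cp j))) (-‿inverseˡ _)))))
    (λ {x} c q →
      let q₁ = All.++⁻ˡ signs q
          q₂ = All.++⁻ʳ signs q
          q₃ = All.++⁻ˡ (equation ones 1#) q₂
          q₄ = All.++⁻ʳ (equation ones 1#) q₂
      in c ,
        (λ i → ≤-respʳ (-‿involutive _) (0≤- (≤-respˡ (eq₁ i c x) (All.tabulate⁻ q₁ i)))) ,
        trans (sym (eq₂ c x)) (equation⁻ q₃) ,
        (λ j → solved (trans (sym (eq₃ j c x)) (equations⁻ coords q₄ j))))
    where
    _⊹⊹_ = All.++⁺
    signs : List (HalfSpace (n ℕ+ d))
    signs = List.tabulate (λ i → (-ᵛ unit i) ++ᵛ 0ᵛ , 0#)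
    ones : W (n ℕ+ d)
    ones = _++ᵛ_ {n} {d} (λ _ → 1#) 0ᵛ
    coords : Vector (W (n ℕ+ d) × Carrier) d
    coords j = (λ i → p i j) ++ᵛ (-ᵛ unit j) , 0#
    system = signs ++ (equation ones 1# ++ equations coords)
    eq₁ : ∀ i c x → ((-ᵛ unit i) ++ᵛ 0ᵛ) · (c ++ᵛ x) ≈ - c i
    eq₁ i c x = trans (·-++ (-ᵛ unit i) c 0ᵛ x) (trans (+-cong (·-neg (unit i) c) (·-zero x))
      (trans (+-identityʳ _) (-‿cong (·-unit i c))))
    eq₂ : ∀ c x → ones · (c ++ᵛ x) ≈ sum c
    eq₂ c x = trans (·-++ (λ _ → 1#) c 0ᵛ x) (trans (+-cong (sum-cong-≋ (λ i → *-identityˡ (c i))) (·-zero x))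
      (+-identityʳ _))
    eq₃ : ∀ j c x → proj₁ (coords j) · (c ++ᵛ x) ≈ - x j + combination c p j
    eq₃ j c x = trans (·-++ (λ i → p i j) c (-ᵛ unit j) x) (trans (+-comm _ _)
      (+-cong (trans (·-neg (unit j) x) (-‿cong (·-unit j x))) (sum-cong-≋ (λ i → *-comm (p i j) (c i)))))
    solved : ∀ {u v} → - u + v ≈ 0# → u ≈ v
    solved {u} {v} e = trans (sym (+-identityʳ u)) (trans (+-congˡ (sym e))
      (trans (sym (+-assoc u (- u) v)) (trans (+-congʳ (-‿inverseʳ u)) (+-identityˡ v))))

  face-polyhedron : ∀ {P : Polytope k d} (F : Face P) → IsPolyhedron (Face.set F)
  face-polyhedron {P = P} F = let _ , a , b , _ , F≐ = Face.isFace F in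
    ≐-polyhedron F≐ (∩-hyperplane-polyhedron a b (≐-polyhedron (Polytope.set≐conv P) (conv-polyhedron (Polytope.points P))))

  wholeFace : (P : Polytope k d) → Face P
  wholeFace P = record
    { set    = Polytope.set P
    ; isFace = Polytope.nonempty P , 0ᵛ , 0# ,
        (λ {x} _ → ≤-reflexive (·-zero x)) , (λ {x} p → p , ·-zero x) , proj₁
    }

  -- ℂ as pairs (real part , imaginary part).
  ℂ : Set
  ℂ = Carrier × Carrier

  ℂ-rawRing : RawRing 0ℓ 0ℓ
  ℂ-rawRing = record
    { Carrier = ℂ
    ; _≈_ = λ (a , b) (a′ , b′) → a ≈ a′ × b ≈ b′
    ; _+_ = λ (a , b) (a′ , b′) → a + a′ , b + b′
    ; _*_ = λ (a , b) (a′ , b′) → a * a′ + - (b * b′) , a * b′ + b * a′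
    ; -_  = λ (a , b) → - a , - b
    ; 0#  = 0# , 0#
    ; 1#  = 1# , 0#
    }

  module ℂ = RawRing ℂ-rawRing

  indicator : Subset d → W d → ℂ
  indicator S x with lem {P = x ∈ S}
  ... | yes _ = ℂ.1#
  ... | no  _ = ℂ.0#

  record NonemptyPolyhedron (d : ℕ) : Set₁ where
    field
      set          : Subset d
      isPolyhedron : IsPolyhedron set
      nonempty     : Satisfiable set

  _+ᴾ_ : NonemptyPolyhedron d → NonemptyPolyhedron d → NonemptyPolyhedron d
  A +ᴾ B = record
    { set          = A.set ⊕ B.set
    ; isPolyhedron = ⊕-polyhedron A.isPolyhedron B.isPolyhedron
    ; nonempty     = let x , x∈A = A.nonempty ; y , y∈B = B.nonempty in
                     x +ᵛ y , x , y , x∈A , y∈B , λ _ → refl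
    }
    where
    module A = NonemptyPolyhedron A
    module B = NonemptyPolyhedron B

  -- M(𝒫(W)): an element is a function in the span of the indicators of
  -- polyhedra, given by a linear combination representing it, and two elements
  -- are equal when they are equal as functions.  Empty polyhedra contribute the
  -- zero function and are left out.
  M : ℕ → Set₁
  M d = List (ℂ × NonemptyPolyhedron d)

  ⟦_⟧ : M d → W d → ℂ
  ⟦ f ⟧ x = List.foldr (λ (c , A) s → (c ℂ.* indicator (NonemptyPolyhedron.set A) x) ℂ.+ s) ℂ.0# f

  infix 4 _≈ᴹ_
  _≈ᴹ_ : Rel (M d) 0ℓ
  f ≈ᴹ g = ∀ x → ⟦ f ⟧ x ℂ.≈ ⟦ g ⟧ x

  [_]ᴹ : NonemptyPolyhedron d → M d
  [ A ]ᴹ = (ℂ.1# , A) ∷ []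

  0ᴹ 1ᴹ : M d
  0ᴹ = []
  1ᴹ = [ record { set = ｛ 0ᵛ ｝ ; isPolyhedron = point-polyhedron 0ᵛ ; nonempty = 0ᵛ , λ _ → refl } ]ᴹ

  infixl 6 _+ᴹ_
  _+ᴹ_ : M d → M d → M d
  _+ᴹ_ = _++_

  infixl 7 _∙ᴹ_
  _∙ᴹ_ : ℂ → M d → M d
  c ∙ᴹ f = List.map (Product.map₁ (c ℂ.*_)) f

  -- The bilinear extension of [ A ]·[ B ] = [ A + B ].
  infixl 7 _*ᴹ_
  _*ᴹ_ : M d → M d → M d
  _*ᴹ_ = cartesianProductWith λ (c , A) (e , B) → c ℂ.* e , A +ᴾ B

  facePolyhedron : {P : Polytope k d} → Face P → NonemptyPolyhedron d
  facePolyhedron F = record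
    { set = Face.set F ; isPolyhedron = face-polyhedron F ; nonempty = Face.nonempty F }

  -- Membership in M(𝓕(P)), the unital subalgebra generated by the nonempty faces.
  data InFaceRing (P : Polytope k d) : M d → Set₁ where
    generator : (F : Face P) → InFaceRing P [ facePolyhedron F ]ᴹ
    zero      : InFaceRing P 0ᴹ
    one       : InFaceRing P 1ᴹ
    add       : ∀ {f g} → InFaceRing P f → InFaceRing P g → InFaceRing P (f +ᴹ g)
    scale     : ∀ c {f} → InFaceRing P f → InFaceRing P (c ∙ᴹ f)
    multiply  : ∀ {f g} → InFaceRing P f → InFaceRing P g → InFaceRing P (f *ᴹ g)
    equal     : ∀ {f g} → f ≈ᴹ g → InFaceRing P f → InFaceRing P g

  minkowskiFaceRing : Polytope k d → RawRing (lsuc 0ℓ) 0ℓ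
  minkowskiFaceRing P = record
    { Carrier = Σ (M _) (InFaceRing P)
    ; _≈_ = λ (f , _) (g , _) → f ≈ᴹ g
    ; _+_ = λ (f , p) (g , q) → f +ᴹ g , add p q
    ; _*_ = λ (f , p) (g , q) → f *ᴹ g , multiply p q
    ; -_  = λ (f , p) → (ℂ.- ℂ.1#) ∙ᴹ f , scale (ℂ.- ℂ.1#) p
    ; 0#  = 0ᴹ , zero
    ; 1#  = 1ᴹ , one
    }

  module MinkowskiFaceRing (P : Polytope k d) where
    private module R = RawRing (minkowskiFaceRing P)
    open R public

    [_] : Face P → R.Carrier
    [ F ] = [ facePolyhedron F ]ᴹ , generator F

    infixl 6 _-_
    _-_ : R.Carrier → R.Carrier → R.Carrier
    f - g = f R.+ (R.- g)

    ∏ : List R.Carrier → R.Carrier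
    ∏ = List.foldr R._*_ R.1#

module Submission where

-- At a point z the product takes the value Σ_T (-1)^|T| [z ∈ B_T], where T runs over the
-- subsets of 𝒞 and B_T is the Minkowski sum of F for F ∈ T and of P for F ∉ T.  If a vertex
-- v lies in no F ∈ 𝒞, then nv, for n = |𝒞|, is only the sum of n copies of v, so it lies in
-- B_∅ alone and the value there is 1.
--
-- Conversely, if every vertex is covered, then P is the convex hull of the union of the Fᵢ,
-- and z ∈ B_T if and only if z = Σ wᵢ with wᵢ ∈ tᵢ Fᵢ, tᵢ ≥ 0, Σ tᵢ = n and tᵢ ≥ 1 for i ∈ T.
-- The solutions (t , w) form a convex set K covered by the half-spaces tᵢ ≥ 1, and the
-- alternating sum of [K ∩ {tᵢ ≥ 1 : i ∈ T} ≠ ∅] over T vanishes because [· ≠ ∅] is a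
-- valuation on convex sets.

open import Defs
open import Level using (0ℓ)
open import Axiom.ExcludedMiddle using (ExcludedMiddle)
open import Data.Bool.Base using (Bool; true; false)
open import Data.Fin.Base using (Fin; zero; suc; punchIn; punchOut)
open import Data.Fin.Properties using (any?; punchIn-punchOut; _≟_)
open import Data.List.Base as List using (List; []; _∷_; _++_; length; lookup; map)
open import Data.List.Membership.Propositional using (lose)
open import Data.List.Membership.Propositional.Properties using (∈-lookup)
open import Data.List.Relation.Unary.All as All using ()
import Data.List.Relation.Unary.All.Properties as All
open import Data.List.Relation.Unary.Any as Any using (Any)
import Data.List.Relation.Unary.Any.Properties as Any
open import Data.Nat.Base using (ℕ; zero; suc)
open import Data.Product.Base as Product using (∃; ∃₂; _×_; _,_; proj₁; proj₂)
open import Data.Sum.Base as Sum using (_⊎_; inj₁; inj₂)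
open import Data.Unit.Base using (⊤; tt)
open import Data.Vec.Base using (Vec; []; _∷_)
open import Data.Vec.Functional as Vector using (Vector; head; tail; removeAt)
open import Function.Base using (_∘_; id)
open import Function.Bundles using (_⇔_; mk⇔)
open import Relation.Binary.PropositionalEquality.Core as ≡ using (_≡_; _≢_; subst)
import Relation.Binary.Reasoning.Setoid as SetoidReasoning
open import Relation.Binary.Structures using (IsTotalOrder)
open import Relation.Nullary using (¬_; Dec; yes; no; contradiction)
open import Relation.Unary using (Pred; _∈_; _⊆_; _≐_; _∩_; Satisfiable)

module MinkowskiIdentity (lem : ∀ {ℓ} → ExcludedMiddle ℓ) (ℝ : CompleteOrderedField) where

  open ConvexGeometry lem ℝ
  open FourierMotzkin
  open CompleteOrderedField ℝ hiding (zero; _-_)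
  open IsTotalOrder isTotalOrder using (total; antisym)
    renaming (trans to ≤-trans; reflexive to ≤-reflexive; ≤-respˡ-≈ to ≤-respˡ; ≤-respʳ-≈ to ≤-respʳ)
  open import Algebra.Properties.Ring ring using (-0#≈0#; -1*x≈-x; -‿+-comm; -‿distribʳ-*)
  open import Algebra.Properties.Semiring.Sum semiring
    using (sum; sum-cong-≋; ∑-distrib-+; ∑-comm; *-distribˡ-sum; *-distribʳ-sum; sum-replicate-zero)
  open import Algebra.Properties.Monoid.Mult +-monoid using () renaming (_×_ to _·ⁿ_)
  open import Algebra.Solver.Ring.NaturalCoefficients.Default commutativeSemiring
    using (solve; _:=_; _:+_; _:*_; con)
  open SetoidReasoning setoid

  private
    variable
      d k m n : ℕ
    module NP {d} = NonemptyPolyhedron {d}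

  -- Truth values in the field and their alternating sums

  χ : Set → Carrier
  χ A with lem {P = A}
  ... | yes _ = 1#
  ... | no  _ = 0#

  χ-cong : ∀ {A B} → (A → B) → (B → A) → χ A ≈ χ B
  χ-cong {A} {B} f g with lem {P = A} | lem {P = B}
  ... | yes _ | yes _ = refl
  ... | yes a | no ¬b = contradiction (f a) ¬b
  ... | no ¬a | yes b = contradiction (g b) ¬a
  ... | no _  | no _  = refl

  χ-true : ∀ {A} → A → χ A ≈ 1#
  χ-true {A} a with lem {P = A}
  ... | yes _ = refl
  ... | no ¬a = contradiction a ¬a

  χ-false : ∀ {A} → ¬ A → χ A ≈ 0#
  χ-false {A} ¬a with lem {P = A}
  ... | yes a = contradiction a ¬a
  ... | no _ = refl

  -- Inclusion-exclusion, since the hypotheses make `A` the disjunction and `A⁰` the conjunction of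
  -- `A⁺` and `A⁻`. For nonemptiness of convex sets, convexity enters only through the last
  -- hypothesis.
  χ-modular : ∀ {A A⁺ A⁻ A⁰} → (A⁺ → A) → (A⁻ → A) → (A⁰ → A⁺) → (A⁰ → A⁻) →
              (A → A⁺ ⊎ A⁻) → (A⁺ → A⁻ → A⁰) → χ A + χ A⁰ ≈ χ A⁺ + χ A⁻
  χ-modular {A} {A⁺} {A⁻} {A⁰} ⁺⇒ ⁻⇒ ⁰⇒⁺ ⁰⇒⁻ cover meet with lem {P = A⁺} | lem {P = A⁻}
  ... | yes p | yes q = +-cong (χ-true (⁺⇒ p)) (χ-true (meet p q))
  ... | yes p | no ¬q = +-cong (χ-true (⁺⇒ p)) (χ-false (¬q ∘ ⁰⇒⁻))
  ... | no ¬p | yes q = trans (+-cong (χ-true (⁻⇒ q)) (χ-false (¬p ∘ ⁰⇒⁺))) (+-comm _ _)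
  ... | no ¬p | no ¬q = +-cong (χ-false (λ a → Sum.[ ¬p , ¬q ] (cover a))) (χ-false (¬p ∘ ⁰⇒⁺))

  -- The sum of (-1)^|T| χ (Q T) over the subsets T of an n-element set.
  alternating : ∀ n → (Vec Bool n → Set) → Carrier
  alternating zero    Q = χ (Q [])
  alternating (suc n) Q = alternating n (Q ∘ (false ∷_)) + - alternating n (Q ∘ (true ∷_))

  alternating-cong : ∀ n {Q R : Vec Bool n → Set} → (∀ T → Q T → R T) → (∀ T → R T → Q T) →
                     alternating n Q ≈ alternating n R
  alternating-cong zero    f g = χ-cong (f []) (g [])
  alternating-cong (suc n) f g = +-cong (alternating-cong n (f ∘ (false ∷_)) (g ∘ (false ∷_)))
    (-‿cong (alternating-cong n (f ∘ (true ∷_)) (g ∘ (true ∷_))))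

  alternating-empty : ∀ n {Q : Vec Bool n → Set} → (∀ T → ¬ Q T) → alternating n Q ≈ 0#
  alternating-empty zero    ¬q = χ-false (¬q [])
  alternating-empty (suc n) ¬q = trans (+-cong (alternating-empty n (¬q ∘ (false ∷_)))
    (trans (-‿cong (alternating-empty n (¬q ∘ (true ∷_)))) -0#≈0#)) (+-identityʳ 0#)

  +-interchange : ∀ a b c e → (a + b) + (c + e) ≈ (a + c) + (b + e)
  +-interchange = solve 4 (λ a b c e → (a :+ b) :+ (c :+ e) := (a :+ c) :+ (b :+ e)) refl

  alternating-modular : ∀ n {Q Q⁺ Q⁻ Q⁰ : Vec Bool n → Set} →
    (∀ T → χ (Q T) + χ (Q⁰ T) ≈ χ (Q⁺ T) + χ (Q⁻ T)) →
    alternating n Q + alternating n Q⁰ ≈ alternating n Q⁺ + alternating n Q⁻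
  alternating-modular zero    mod = mod []
  alternating-modular (suc n) mod = begin
    _ ≈⟨ +-interchange _ _ _ _ ⟩
    _ ≈⟨ +-cong (alternating-modular n (mod ∘ (false ∷_)))
           (trans (-‿+-comm _ _) (trans (-‿cong (alternating-modular n (mod ∘ (true ∷_)))) (sym (-‿+-comm _ _)))) ⟩
    _ ≈⟨ +-interchange _ _ _ _ ⟩
    _ ∎

  -- Ordered field arithmetic

  x≈y⇒x-y≈0 : ∀ {x y} → x ≈ y → x + - y ≈ 0#
  x≈y⇒x-y≈0 {x} {y} p = trans (+-congʳ p) (-‿inverseʳ y)

  x-y≈0⇒x≈y : ∀ {x y} → x + - y ≈ 0# → x ≈ y
  x-y≈0⇒x≈y {x} {y} p = trans (sym (cancel′ x y)) (trans (+-congʳ p) (+-identityˡ y))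

  +-cancelʳ-≈ : ∀ z {x y} → x + z ≈ y + z → x ≈ y
  +-cancelʳ-≈ z {x} {y} p = trans (sym (cancel x z)) (trans (+-congʳ p) (cancel y z))

  ≤-resp : ∀ {x x′ y y′} → x ≈ x′ → y ≈ y′ → x ≤ y → x′ ≤ y′
  ≤-resp p q r = ≤-respˡ p (≤-respʳ q r)

  +-nonneg : ∀ {x y} → 0# ≤ x → 0# ≤ y → 0# ≤ x + y
  +-nonneg p q = ≤-respˡ (+-identityˡ 0#) (+-mono-≤ p q)

  x≤x+y : ∀ {x y} → 0# ≤ y → x ≤ x + y
  x≤x+y {x} p = ≤-respˡ (+-identityʳ x) (+-mono-≤ ≤-refl p)

  x≤y+x : ∀ {x y} → 0# ≤ y → x ≤ y + x
  x≤y+x p = ≤-respʳ (+-comm _ _) (x≤x+y p)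

  +-nonneg-≈0ˡ : ∀ {x y} → 0# ≤ x → 0# ≤ y → x + y ≈ 0# → x ≈ 0#
  +-nonneg-≈0ˡ p q e = antisym (≤-respʳ e (x≤x+y q)) p

  sum-nonneg : ∀ {c : Vector Carrier n} → (∀ i → 0# ≤ c i) → 0# ≤ sum c
  sum-nonneg {zero}  p = ≤-refl
  sum-nonneg {suc n} p = +-nonneg (p zero) (sum-nonneg (p ∘ suc))

  -- With `a = s - 1` and `b = 1 - t`, the point dividing the segment from `s` to `t` in the ratio
  -- `a : b` is 1, so the weights are `b / (a + b)` and `a / (a + b)`.
  crossing : ∀ {s t} → 1# ≤ s → t ≤ 1# →
             ∃₂ λ λ₁ λ₂ → 0# ≤ λ₁ × 0# ≤ λ₂ × λ₁ + λ₂ ≈ 1# × λ₁ * s + λ₂ * t ≈ 1#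
  crossing {s} {t} 1≤s t≤1 = go (lem {P = a + b ≈ 0#})
    where
    a = s + - 1#
    b = 1# + - t
    0≤a = diff 1≤s
    0≤b = diff t≤1
    a+1≈s = cancel′ s 1#
    b+t≈1 = cancel′ 1# t
    go : Dec (a + b ≈ 0#) → _
    -- Here `a` and `b` vanish, so `s` is already 1 and takes all the weight.
    go (yes a+b≈0) = 1# , 0# , 0≤1 , ≤-refl , +-identityʳ 1# , (begin
      1# * s + 0# * t ≈⟨ +-cong (*-identityˡ s) (zeroˡ t) ⟩
      s + 0#          ≈⟨ +-identityʳ s ⟩
      s               ≈⟨ x-y≈0⇒x≈y (+-nonneg-≈0ˡ 0≤a 0≤b a+b≈0) ⟩
      1#              ∎)
    go (no a+b≉0) with positiveInverse (+-nonneg 0≤a 0≤b) a+b≉0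
    ... | κ , 0≤κ , κ[a+b]≈1 = κ * b , κ * a , *-nonneg 0≤κ 0≤b , *-nonneg 0≤κ 0≤a ,
      trans (solve 3 (λ κ a b → κ :* b :+ κ :* a := κ :* (a :+ b)) refl κ a b) κ[a+b]≈1 , (begin
      κ * b * s + κ * a * t        ≈⟨ +-congʳ (*-congˡ (sym a+1≈s)) ⟩
      κ * b * (a + 1#) + κ * a * t ≈⟨ solve 4 (λ κ a b t →
        κ :* b :* (a :+ con 1) :+ κ :* a :* t := κ :* (a :* (b :+ t) :+ b)) refl κ a b t ⟩
      κ * (a * (b + t) + b)        ≈⟨ *-congˡ (+-congʳ (trans (*-congˡ b+t≈1) (*-identityʳ a))) ⟩
      κ * (a + b)                  ≈⟨ κ[a+b]≈1 ⟩
      1#                           ∎)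

  mix-mono : ∀ {λ₁ λ₂ r r′ s t} → 0# ≤ λ₁ → 0# ≤ λ₂ → r ≤ s → r′ ≤ t →
             λ₁ * r + λ₂ * r′ ≤ λ₁ * s + λ₂ * t
  mix-mono 0≤λ₁ 0≤λ₂ p q = +-mono-≤ (*-monoˡ-≤ 0≤λ₁ p) (*-monoˡ-≤ 0≤λ₂ q)

  mix-same : ∀ {λ₁ λ₂} r → λ₁ + λ₂ ≈ 1# → λ₁ * r + λ₂ * r ≈ r
  mix-same r Σ≈1 = trans (sym (distribʳ r _ _)) (trans (*-congʳ Σ≈1) (*-identityˡ r))

  -- Convex sets covered by half-spaces

  -- The condition `tᵢ ≥ 1` for `i ∈ T`, by recursion on `T` so that it unfolds along with
  -- `alternating`.
  Exceeds : Vec Bool n → Vector Carrier n → Set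
  Exceeds []          t = ⊤
  Exceeds (false ∷ T) t = Exceeds T (tail t)
  Exceeds (true ∷ T)  t = 1# ≤ head t × Exceeds T (tail t)

  Exceeds-mono : ∀ (T : Vec Bool n) {s t} → (∀ i → s i ≤ t i) → Exceeds T s → Exceeds T t
  Exceeds-mono []          p _       = tt
  Exceeds-mono (false ∷ T) p e       = Exceeds-mono T (p ∘ suc) e
  Exceeds-mono (true ∷ T)  p (q , e) = ≤-trans q (p zero) , Exceeds-mono T (p ∘ suc) e

  -- `mix λ₁ λ₂ x y` stands for `λ₁ x + λ₂ y`; the points will be families of pairs `(tᵢ , wᵢ)`.
  module Covering {X : Set} (mix : Carrier → Carrier → X → X → X) where

    Convex : Pred X 0ℓ → Set
    Convex K = ∀ {λ₁ λ₂ x y} → 0# ≤ λ₁ → 0# ≤ λ₂ → λ₁ + λ₂ ≈ 1# → x ∈ K → y ∈ K → mix λ₁ λ₂ x y ∈ K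

    Affine : (X → Carrier) → Set
    Affine ℓ = ∀ λ₁ λ₂ x y → ℓ (mix λ₁ λ₂ x y) ≈ λ₁ * ℓ x + λ₂ * ℓ y

    Exceeds-convex : ∀ (T : Vec Bool n) {ℓ : Fin n → X → Carrier} → (∀ i → Affine (ℓ i)) →
                     Convex (λ x → Exceeds T (λ i → ℓ i x))
    Exceeds-convex []          aff 0≤λ₁ 0≤λ₂ Σ≈1 _ _ = tt
    Exceeds-convex (false ∷ T) aff 0≤λ₁ 0≤λ₂ Σ≈1 p q = Exceeds-convex T (aff ∘ suc) 0≤λ₁ 0≤λ₂ Σ≈1 p q
    Exceeds-convex (true ∷ T)  aff 0≤λ₁ 0≤λ₂ Σ≈1 (p , ps) (q , qs) =
      ≤-resp (mix-same 1# Σ≈1) (sym (aff zero _ _ _ _)) (mix-mono 0≤λ₁ 0≤λ₂ p q) ,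
      Exceeds-convex T (aff ∘ suc) 0≤λ₁ 0≤λ₂ Σ≈1 ps qs

    ∩-convex : ∀ K L → Convex K → Convex L → Convex (K ∩ L)
    ∩-convex K L cK cL p q e (x∈K , x∈L) (y∈K , y∈L) = cK p q e x∈K y∈K , cL p q e x∈L y∈L

    -- A convex set is cut by the hyperplane ℓ = 1 into two parts that meet
    -- exactly when both are nonempty.
    cut : ∀ {K ℓ} → Convex K → Affine ℓ →
      χ (Satisfiable K) + χ (Satisfiable (K ∩ λ x → ℓ x ≈ 1#)) ≈
      χ (Satisfiable (K ∩ λ x → 1# ≤ ℓ x)) + χ (Satisfiable (K ∩ λ x → ℓ x ≤ 1#))
    cut {K} {ℓ} convex affine = χ-modular
      (Product.map₂ proj₁) (Product.map₂ proj₁)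
      (λ (x , x∈K , e) → x , x∈K , ≤-reflexive (sym e))
      (λ (x , x∈K , e) → x , x∈K , ≤-reflexive e)
      (λ (x , x∈K) → Sum.map (λ p → x , x∈K , p) (λ p → x , x∈K , p) (total 1# (ℓ x)))
      (λ (x , x∈K , p) (y , y∈K , q) →
        let λ₁ , λ₂ , 0≤λ₁ , 0≤λ₂ , Σ≈1 , e = crossing p q in
        mix λ₁ λ₂ x y , convex 0≤λ₁ 0≤λ₂ Σ≈1 x∈K y∈K , trans (affine λ₁ λ₂ x y) e)

    -- If ℓ₀ + … + ℓₙ ≥ n + 1 on K, then K is covered by the half-spaces ℓᵢ ≥ 1.
    -- On the part of K where ℓ₀ ≤ 1 the remaining half-spaces satisfy the same
    -- hypothesis, so only the part where ℓ₀ ≥ 1 contributes, and there the terms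
    -- with and without ℓ₀ cancel.
    covering : ∀ n {K} {ℓ : Fin (suc n) → X → Carrier} → Convex K → (∀ i → Affine (ℓ i)) →
      (∀ {x} → x ∈ K → suc n ·ⁿ 1# ≤ sum (λ i → ℓ i x)) →
      alternating (suc n) (λ T → Satisfiable (K ∩ λ x → Exceeds T (λ i → ℓ i x))) ≈ 0#
    covering zero {K} {ℓ} convex affine covered = x≈y⇒x-y≈0 (χ-cong
      (λ (x , x∈K , _) → x , x∈K , ≤-resp (+-identityʳ 1#) (+-identityʳ _) (covered x∈K) , tt)
      (λ (x , x∈K , _) → x , x∈K , tt))
    covering (suc n) {K} {ℓ} convex affine covered = x≈y⇒x-y≈0 (begin
      Σₙ Q                              ≈⟨ +-identityʳ _ ⟨
      -- The slices `ℓ₀ = 1` and `ℓ₀ ≤ 1` both have alternating sum zero by induction, so modularity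
      -- leaves `Q` against `Q⁺`.
      Σₙ Q + 0#                         ≈⟨ +-congˡ (covering n (∩-convex K _ convex ⁼-convex)
        (affine ∘ suc) (λ (x∈K , e) → rest (≤-reflexive e) x∈K)) ⟨
      Σₙ Q + Σₙ Q⁰                      ≈⟨ alternating-modular (suc n) modular ⟩
      Σₙ Q⁺ + Σₙ Q⁻                     ≈⟨ +-congˡ (covering n (∩-convex K _ convex ≤-convex)
        (affine ∘ suc) (λ (x∈K , p) → rest p x∈K)) ⟩
      Σₙ Q⁺ + 0#                        ≈⟨ +-identityʳ _ ⟩
      Σₙ Q⁺                             ∎)
      where
      Σₙ = alternating (suc n)
      ℓ₀ = ℓ zero
      E : Vec Bool (suc n) → Pred X 0ℓ
      E T x = Exceeds T (λ i → ℓ (suc i) x)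
      Q Q⁺ Q⁻ Q⁰ : Vec Bool (suc n) → Set
      Q  T = Satisfiable (K ∩ E T)
      Q⁺ T = Satisfiable (K ∩ λ x → 1# ≤ ℓ₀ x × x ∈ E T)
      Q⁻ T = Satisfiable ((K ∩ λ x → ℓ₀ x ≤ 1#) ∩ E T)
      Q⁰ T = Satisfiable ((K ∩ λ x → ℓ₀ x ≈ 1#) ∩ E T)
      ⁼-convex : Convex (λ x → ℓ₀ x ≈ 1#)
      ⁼-convex _ _ Σ≈1 p q = trans (affine zero _ _ _ _) (trans (+-cong (*-congˡ p) (*-congˡ q)) (mix-same 1# Σ≈1))
      ≤-convex : Convex (λ x → ℓ₀ x ≤ 1#)
      ≤-convex 0≤λ₁ 0≤λ₂ Σ≈1 p q = ≤-resp (sym (affine zero _ _ _ _)) (mix-same 1# Σ≈1) (mix-mono 0≤λ₁ 0≤λ₂ p q)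
      rest : ∀ {x} → ℓ₀ x ≤ 1# → x ∈ K → suc n ·ⁿ 1# ≤ sum (λ i → ℓ (suc i) x)
      rest p x∈K = +-cancelʳ-≤ 1# (≤-trans (≤-respˡ (+-comm _ _) (covered x∈K))
        (≤-respʳ (+-comm _ _) (+-monoˡ-≤ _ p)))
      modular : ∀ T → χ (Q T) + χ (Q⁰ T) ≈ χ (Q⁺ T) + χ (Q⁻ T)
      modular T = begin
        _ ≈⟨ +-congˡ (χ-cong swap swap) ⟩
        _ ≈⟨ cut (∩-convex K (E T) convex (Exceeds-convex T (affine ∘ suc))) (affine zero) ⟩
        _ ≈⟨ +-cong (χ-cong (λ (x , (k , e) , p) → x , k , p , e) (λ (x , k , p , e) → x , (k , e) , p)) (χ-cong swap swap) ⟩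
        _ ∎
        where
        swap : ∀ {K L M : Pred X 0ℓ} → Satisfiable ((K ∩ L) ∩ M) → Satisfiable ((K ∩ M) ∩ L)
        swap (x , (k , l) , m) = x , (k , m) , l

  -- Cones over polyhedra

  polyhedron-convex : ∀ {S : Subset d} → IsPolyhedron S → ∀ {λ₁ λ₂ x y} →
    0# ≤ λ₁ → 0# ≤ λ₂ → λ₁ + λ₂ ≈ 1# → x ∈ S → y ∈ S → λ₁ *ᵛ x +ᵛ λ₂ *ᵛ y ∈ S
  polyhedron-convex (hs , S⊆hs , hs⊆S) {λ₁} {λ₂} {x} {y} 0≤λ₁ 0≤λ₂ Σ≈1 x∈S y∈S =
    hs⊆S (All.zipWith (λ {h} → mixed h) (S⊆hs x∈S , S⊆hs y∈S))
    where
    ·-scaleʳ : ∀ c (a v : W _) → a · (c *ᵛ v) ≈ c * (a · v)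
    ·-scaleʳ c a v = trans
      (sum-cong-≋ (λ i → solve 3 (λ a c v → a :* (c :* v) := c :* a :* v) refl (a i) c (v i)))
      (·-scale c a v)
    mixed : ∀ h → x ∈ᴴ h × y ∈ᴴ h → λ₁ *ᵛ x +ᵛ λ₂ *ᵛ y ∈ᴴ h
    mixed (a , b) (p , q) = ≤-resp
      (sym (trans (·-distribˡ a _ _) (+-cong (·-scaleʳ λ₁ a x) (·-scaleʳ λ₂ a y))))
      (mix-same b Σ≈1) (mix-mono 0≤λ₁ 0≤λ₂ p q)

  -- The cone over `{1} × S`, that is `w ∈ t S`. At `t ≈ 0` it forces `w ≋ 0ᵛ`, so recession
  -- directions of `S` do not enter.
  Cone : Subset d → Carrier × W d → Set
  Cone S (t , w) = 0# ≤ t × ∃ λ f → f ∈ S × w ≋ t *ᵛ f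

  cone-resp : ∀ {S : Subset d} {t t′ w w′} → t ≈ t′ → w ≋ w′ → Cone S (t , w) → Cone S (t′ , w′)
  cone-resp t≈t′ w≋w′ (0≤t , f , f∈S , w≋tf) =
    ≤-respʳ t≈t′ 0≤t , f , f∈S , λ j → trans (sym (w≋w′ j)) (trans (w≋tf j) (*-congʳ t≈t′))

  cone-zero : ∀ {S : Subset d} → Satisfiable S → Cone S (0# , 0ᵛ)
  cone-zero (f , f∈S) = ≤-refl , f , f∈S , λ j → sym (zeroˡ (f j))

  cone-one : ∀ {S : Subset d} {y} → y ∈ S → Cone S (1# , y)
  cone-one {y = y} y∈S = 0≤1 , y , y∈S , λ j → sym (*-identityˡ (y j))

  cone-scale : ∀ {S : Subset d} {c t w} → 0# ≤ c → Cone S (t , w) → Cone S (c * t , c *ᵛ w)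
  cone-scale 0≤c (0≤t , f , f∈S , w≋tf) =
    *-nonneg 0≤c 0≤t , f , f∈S , λ j → trans (*-congˡ (w≋tf j)) (sym (*-assoc _ _ _))

  cone-⊆ : ∀ {S S′ : Subset d} → S ⊆ S′ → ∀ {tw} → Cone S tw → Cone S′ tw
  cone-⊆ S⊆S′ (0≤t , f , f∈S , w≋tf) = 0≤t , f , S⊆S′ f∈S , w≋tf

  -- By convexity `t f + s g = (t + s) h` with `h = (t f + s g) / (t + s)` in `S`.
  cone-+ : ∀ {S : Subset d} → IsPolyhedron S → ∀ {t s w v} →
           Cone S (t , w) → Cone S (s , v) → Cone S (t + s , w +ᵛ v)
  cone-+ {S = S} polyhedral {t} {s} {w} {v} (0≤t , f , f∈S , w≋tf) (0≤s , g , g∈S , v≋sg) =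
    +-nonneg 0≤t 0≤s , go (lem {P = t + s ≈ 0#})
    where
    go : Dec (t + s ≈ 0#) → ∃ λ h → h ∈ S × w +ᵛ v ≋ (t + s) *ᵛ h
    -- Both weights vanish, so any point of `S` can serve as `h`.
    go (yes t+s≈0) = f , f∈S , λ j → begin
      w j + v j           ≈⟨ +-cong (w≋tf j) (v≋sg j) ⟩
      t * f j + s * g j   ≈⟨ +-cong (vanish t≈0 (f j)) (vanish s≈0 (g j)) ⟩
      0# + 0#             ≈⟨ +-identityʳ 0# ⟩
      0#                  ≈⟨ vanish t+s≈0 (f j) ⟨
      (t + s) * f j       ∎
      where
      vanish : ∀ {c} → c ≈ 0# → ∀ x → c * x ≈ 0#
      vanish c≈0 x = trans (*-congʳ c≈0) (zeroˡ x)
      t≈0 = +-nonneg-≈0ˡ 0≤t 0≤s t+s≈0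
      s≈0 = +-nonneg-≈0ˡ 0≤s 0≤t (trans (+-comm s t) t+s≈0)
    go (no t+s≉0) with positiveInverse (+-nonneg 0≤t 0≤s) t+s≉0
    ... | κ , 0≤κ , κ[t+s]≈1 = _ ,
      polyhedron-convex polyhedral (*-nonneg 0≤κ 0≤t) (*-nonneg 0≤κ 0≤s)
        (trans (sym (distribˡ κ t s)) κ[t+s]≈1) f∈S g∈S ,
      λ j → begin
      w j + v j                                         ≈⟨ +-cong (w≋tf j) (v≋sg j) ⟩
      t * f j + s * g j                                 ≈⟨ *-identityˡ _ ⟨
      1# * (t * f j + s * g j)                          ≈⟨ *-congʳ κ[t+s]≈1 ⟨
      κ * (t + s) * (t * f j + s * g j)                 ≈⟨ solve 5 (λ κ t s f g →
        κ :* (t :+ s) :* (t :* f :+ s :* g) := (t :+ s) :* (κ :* t :* f :+ κ :* s :* g)) refl κ t s (f j) (g j) ⟩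
      (t + s) * (κ * t * f j + κ * s * g j)             ∎

  cone-minus-one : ∀ {S : Subset d} {t w} → 1# ≤ t → Cone S (t , w) →
                   ∃₂ λ f v → f ∈ S × Cone S (t + - 1# , v) × w ≋ f +ᵛ v
  cone-minus-one {t = t} {w} 1≤t (_ , f , f∈S , w≋tf) =
    f , (t + - 1#) *ᵛ f , f∈S , (diff 1≤t , f , f∈S , λ _ → refl) , λ j → begin
    w j                              ≈⟨ w≋tf j ⟩
    t * f j                          ≈⟨ *-congʳ (cancel′ t 1#) ⟨
    (t + - 1# + 1#) * f j            ≈⟨ solve 2 (λ c f → (c :+ con 1) :* f := f :+ c :* f) refl _ (f j) ⟩
    f j + (t + - 1#) * f j           ∎

  -- Decompositions of a point over several cones

  Weighted : ℕ → ℕ → Set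
  Weighted n d = Vector (Carrier × W d) n

  mix : Carrier → Carrier → Weighted n d → Weighted n d → Weighted n d
  mix λ₁ λ₂ x y i = λ₁ * proj₁ (x i) + λ₂ * proj₁ (y i) , λ₁ *ᵛ proj₂ (x i) +ᵛ λ₂ *ᵛ proj₂ (y i)

  -- For `t` the number of faces these are the points of the convex set K. The total weight is a
  -- parameter because `t = 1` describes the hull of the union of the `Fᵢ`, and sums are built up
  -- one summand at a time.
  record Decomposes (F : Vector (NonemptyPolyhedron d) n) (t : Carrier) (w : W d) (x : Weighted n d) : Set where
    field
      member : ∀ i → Cone (NP.set (F i)) (x i)
      weight : sum (proj₁ ∘ x) ≈ t
      value  : ∀ j → sum (λ i → proj₂ (x i) j) ≈ w j
  open Decomposes

  module _ (F : Vector (NonemptyPolyhedron d) n) where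

    decomposes-resp : ∀ {t t′ w w′ x} → t ≈ t′ → w ≋ w′ → Decomposes F t w x → Decomposes F t′ w′ x
    decomposes-resp t≈t′ w≋w′ D = record
      { member = member D
      ; weight = trans (weight D) t≈t′
      ; value  = λ j → trans (value D j) (w≋w′ j)
      }

    -- Cones are closed under nonnegative combinations. Coefficients of sum 1 give convexity of K,
    -- coefficients 1 and 1 give additivity.
    decomposes-mix : ∀ {λ₁ λ₂ t t′ w w′ x y} → 0# ≤ λ₁ → 0# ≤ λ₂ → Decomposes F t w x → Decomposes F t′ w′ y →
      Decomposes F (λ₁ * t + λ₂ * t′) (λ₁ *ᵛ w +ᵛ λ₂ *ᵛ w′) (mix λ₁ λ₂ x y)
    decomposes-mix {λ₁} {λ₂} {x = x} {y} 0≤λ₁ 0≤λ₂ D E = record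
      { member = λ i → cone-+ (NP.isPolyhedron (F i)) (cone-scale 0≤λ₁ (member D i)) (cone-scale 0≤λ₂ (member E i))
      ; weight = trans (linear (proj₁ ∘ x) (proj₁ ∘ y)) (+-cong (*-congˡ (weight D)) (*-congˡ (weight E)))
      ; value  = λ j → trans (linear (λ i → proj₂ (x i) j) (λ i → proj₂ (y i) j))
          (+-cong (*-congˡ (value D j)) (*-congˡ (value E j)))
      }
      where
      linear : ∀ (u v : Vector Carrier n) → sum (λ i → λ₁ * u i + λ₂ * v i) ≈ λ₁ * sum u + λ₂ * sum v
      linear u v = trans (∑-distrib-+ (λ i → λ₁ * u i) (λ i → λ₂ * v i))
        (+-cong (sym (*-distribˡ-sum λ₁ u)) (sym (*-distribˡ-sum λ₂ v)))

    decomposes-zero : Decomposes F 0# 0ᵛ (λ _ → 0# , 0ᵛ)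
    decomposes-zero = record
      { member = λ i → cone-zero (NP.nonempty (F i))
      ; weight = sum-replicate-zero n
      ; value  = λ _ → sum-replicate-zero n
      }

    open Covering (mix {n} {d}) using (Convex)

    decomposes-convex : ∀ {t w} → Convex (Decomposes F t w)
    decomposes-convex 0≤λ₁ 0≤λ₂ Σ≈1 D E = decomposes-resp
      (mix-same _ Σ≈1) (λ j → mix-same _ Σ≈1) (decomposes-mix 0≤λ₁ 0≤λ₂ D E)

    -- All weights are nonnegative, so adding a decomposition lowers none of them; this preserves
    -- `Exceeds`.
    decomposes-+ : ∀ {t t′ w w′ x y} → Decomposes F t w x → Decomposes F t′ w′ y →
      ∃ λ z → Decomposes F (t + t′) (w +ᵛ w′) z ×
              (∀ i → proj₁ (x i) ≤ proj₁ (z i)) × (∀ i → proj₁ (y i) ≤ proj₁ (z i))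
    decomposes-+ {x = x} {y} D E = mix 1# 1# x y ,
      decomposes-resp (unscale _ _) (λ j → unscale _ _) (decomposes-mix 0≤1 0≤1 D E) ,
      (λ i → ≤-respʳ (sym (unscale _ _)) (x≤x+y (proj₁ (member E i)))) ,
      (λ i → ≤-respʳ (sym (unscale _ _)) (x≤y+x (proj₁ (member D i))))
      where
      unscale : ∀ a b → 1# * a + 1# * b ≈ a + b
      unscale a b = +-cong (*-identityˡ a) (*-identityˡ b)

  decomposes-single : (F : Vector (NonemptyPolyhedron d) n) → ∀ i {t w} → Cone (NP.set (F i)) (t , w) →
    ∃ λ x → Decomposes F t w x × proj₁ (x i) ≈ t
  decomposes-single F zero {t} {w} c = ((t , w) Vector.∷ λ _ → 0# , 0ᵛ) , record
    { member = λ { zero → c ; (suc i) → member rest i }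
    ; weight = trans (+-congˡ (weight rest)) (+-identityʳ t)
    ; value  = λ j → trans (+-congˡ (value rest j)) (+-identityʳ (w j))
    } , refl
    where
    rest = decomposes-zero (tail F)
  decomposes-single F (suc i) {t} {w} c with decomposes-single (tail F) i c
  ... | x , D , e = ((0# , 0ᵛ) Vector.∷ x) , record
    { member = λ { zero → cone-zero (NP.nonempty (F zero)) ; (suc i) → member D i }
    ; weight = trans (+-identityˡ _) (weight D)
    ; value  = λ j → trans (+-identityˡ _) (value D j)
    } , e

  -- Each term `cₖ qₖ` goes to the cone over one `Fᵢ` containing `qₖ`.
  decomposes-combination : (F : Vector (NonemptyPolyhedron d) n) (c : W m) (q : Vector (W d) m) →
    (∀ k → 0# ≤ c k) → (∀ k → ∃ λ i → q k ∈ NP.set (F i)) → ∃ (Decomposes F (sum c) (combination c q))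
  decomposes-combination {m = zero}  F c q 0≤c covered = _ , decomposes-zero F
  decomposes-combination {m = suc m} F c q 0≤c covered =
    let i , q∈F   = covered zero
        _ , D , _ = decomposes-single F i (0≤c zero , head q , q∈F , λ _ → refl)
        _ , E     = decomposes-combination F (tail c) (tail q) (0≤c ∘ suc) (covered ∘ suc)
        _ , G , _ = decomposes-+ F D E
    in _ , G

  -- Minkowski sums of faces

  module Choices (P : Polytope k d) where
    private
      Pᴾ = facePolyhedron (wholeFace P)
      module P = Polytope P

    Choice : List (Face P) → Set
    Choice C = Vec Bool (length C)

    members : (C : List (Face P)) → Vector (NonemptyPolyhedron d) (length C)
    members C i = facePolyhedron (lookup C i)

    -- The set `B_T`, bracketed as `∏` multiplies so that expanding the product yields it literally.
    choiceSum : (C : List (Face P)) → Choice C → Subset d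
    choiceSum []      []          = ｛ 0ᵛ ｝
    choiceSum (F ∷ C) (true ∷ T)  = Face.set F ⊕ choiceSum C T
    choiceSum (F ∷ C) (false ∷ T) = P.set ⊕ choiceSum C T

    choiceSum-resp : ∀ C T {x y} → x ≋ y → x ∈ choiceSum C T → y ∈ choiceSum C T
    choiceSum-resp []      []          x≋y x≋0 = λ j → trans (sym (x≋y j)) (x≋0 j)
    choiceSum-resp (F ∷ C) (true ∷ T)  x≋y (u , v , u∈ , v∈ , e) = u , v , u∈ , v∈ , λ j → trans (sym (x≋y j)) (e j)
    choiceSum-resp (F ∷ C) (false ∷ T) x≋y (u , v , u∈ , v∈ , e) = u , v , u∈ , v∈ , λ j → trans (sym (x≋y j)) (e j)

    face-⊆ : (F : Face P) → Face.set F ⊆ P.set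
    face-⊆ F x∈F = let _ , _ , _ , _ , F⊆ , _ = Face.isFace F in proj₁ (F⊆ x∈F)

    chosenSum : (C : List (Face P)) → Choice C → Subset d
    chosenSum []      []          = ｛ 0ᵛ ｝
    chosenSum (F ∷ C) (true ∷ T)  = Face.set F ⊕ chosenSum C T
    chosenSum (F ∷ C) (false ∷ T) = chosenSum C T

    -- The number `n - |T|` as a field element: `B_T` is `(n - |T|) P` plus `chosenSum C T`.
    unchosen : (C : List (Face P)) → Choice C → Carrier
    unchosen []      []          = 0#
    unchosen (F ∷ C) (true ∷ T)  = unchosen C T
    unchosen (F ∷ C) (false ∷ T) = 1# + unchosen C T

    unchosen-nonneg : ∀ C T → 0# ≤ unchosen C T
    unchosen-nonneg []      []          = ≤-refl
    unchosen-nonneg (F ∷ C) (true ∷ T)  = unchosen-nonneg C T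
    unchosen-nonneg (F ∷ C) (false ∷ T) = +-nonneg 0≤1 (unchosen-nonneg C T)

    -- Every summand `P` receives the same point `p`, by `(1 + ρ) p = p + ρ p`.
    assemble : ∀ C T {u s z} → Cone P.set (unchosen C T , u) → s ∈ chosenSum C T → z ≋ u +ᵛ s →
               z ∈ choiceSum C T
    assemble [] [] {u} {s} {z} (_ , f , _ , u≋0f) s≋0 z≋u+s = λ j → begin
      z j           ≈⟨ z≋u+s j ⟩
      u j + s j     ≈⟨ +-cong (trans (u≋0f j) (zeroˡ (f j))) (s≋0 j) ⟩
      0# + 0#       ≈⟨ +-identityʳ 0# ⟩
      0#            ∎
    assemble (F ∷ C) (false ∷ T) {u} {s} {z} (_ , p , p∈P , u≋) s∈ z≋u+s =
      p , ρ *ᵛ p +ᵛ s , p∈P ,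
      assemble C T (unchosen-nonneg C T , p , p∈P , λ _ → refl) s∈ (λ _ → refl) , λ j → begin
      z j                       ≈⟨ z≋u+s j ⟩
      u j + s j                 ≈⟨ +-congʳ (u≋ j) ⟩
      (1# + ρ) * p j + s j      ≈⟨ solve 3 (λ ρ p s → (con 1 :+ ρ) :* p :+ s := p :+ (ρ :* p :+ s)) refl ρ (p j) (s j) ⟩
      p j + (ρ * p j + s j)     ∎
      where
      ρ = unchosen C T
    assemble (F ∷ C) (true ∷ T) {u} {s} {z} cone (f , s′ , f∈F , s′∈ , s≋f+s′) z≋u+s =
      f , u +ᵛ s′ , f∈F , assemble C T cone s′∈ (λ _ → refl) , λ j → begin
      z j                  ≈⟨ z≋u+s j ⟩
      u j + s j            ≈⟨ +-congˡ (s≋f+s′ j) ⟩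
      u j + (f j + s′ j)   ≈⟨ solve 3 (λ u f s → u :+ (f :+ s) := f :+ (u :+ s)) refl (u j) (f j) (s′ j) ⟩
      f j + (u j + s′ j)   ∎

    -- Splits one point of Fᵢ off wᵢ for each i in T; what remains lies in a multiple of P.
    split : ∀ C (x : Weighted (length C) d) → (∀ i → Cone (Face.set (lookup C i)) (x i)) →
      ∀ T → Exceeds T (proj₁ ∘ x) →
      ∃₂ λ r u → ∃ λ s → Cone P.set (r , u) × s ∈ chosenSum C T ×
        (∀ j → sum (λ i → proj₂ (x i) j) ≈ u j + s j) ×
        r + length C ·ⁿ 1# ≈ sum (proj₁ ∘ x) + unchosen C T
    split [] x x∈ [] _ = 0# , 0ᵛ , 0ᵛ , cone-zero P.nonempty , (λ _ → refl) , (λ _ → sym (+-identityʳ 0#)) , refl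
    split (F ∷ C) x x∈ (false ∷ T) e with split C (tail x) (x∈ ∘ suc) T e
    ... | r , u , s , cone , s∈ , value , weight =
      t + r , w +ᵛ u , s , cone-+ (NP.isPolyhedron Pᴾ) (cone-⊆ (face-⊆ F) (x∈ zero)) cone , s∈ ,
      (λ j → trans (+-congˡ (value j)) (sym (+-assoc _ _ _))) , (begin
      t + r + (1# + N)          ≈⟨ solve 3 (λ t r N → t :+ r :+ (con 1 :+ N) := t :+ (r :+ N) :+ con 1) refl t r N ⟩
      t + (r + N) + 1#          ≈⟨ +-congʳ (+-congˡ weight) ⟩
      t + (σ + υ) + 1#          ≈⟨ solve 3 (λ t σ υ → t :+ (σ :+ υ) :+ con 1 := t :+ σ :+ (con 1 :+ υ)) refl t σ υ ⟩
      t + σ + (1# + υ)          ∎)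
      where
      t = proj₁ (x zero)
      w = proj₂ (x zero)
      N = length C ·ⁿ 1#
      σ = sum (proj₁ ∘ tail x)
      υ = unchosen C T
    split (F ∷ C) x x∈ (true ∷ T) (1≤t , e) with split C (tail x) (x∈ ∘ suc) T e | cone-minus-one 1≤t (x∈ zero)
    ... | r , u , s , cone , s∈ , value , weight | f , v , f∈F , cone′ , w≋f+v =
      t + - 1# + r , v +ᵛ u , f +ᵛ s , cone-+ (NP.isPolyhedron Pᴾ) (cone-⊆ (face-⊆ F) cone′) cone ,
      (f , s , f∈F , s∈ , λ _ → refl) ,
      (λ j → trans (+-cong (w≋f+v j) (value j))
        (solve 4 (λ f v u s → (f :+ v) :+ (u :+ s) := (v :+ u) :+ (f :+ s)) refl (f j) (v j) (u j) (s j))) , (begin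
      t + - 1# + r + (1# + N)    ≈⟨ solve 4 (λ t o r N →
        t :+ o :+ r :+ (con 1 :+ N) := (t :+ o :+ con 1) :+ (r :+ N)) refl t (- 1#) r N ⟩
      (t + - 1# + 1#) + (r + N)  ≈⟨ +-cong (cancel′ t 1#) weight ⟩
      t + (σ + υ)                ≈⟨ +-assoc t σ υ ⟨
      t + σ + υ                  ∎)
      where
      t = proj₁ (x zero)
      N = length C ·ⁿ 1#
      σ = sum (proj₁ ∘ tail x)
      υ = unchosen C T

    decomposition⇒∈choiceSum : ∀ C T {z} →
      Satisfiable (Decomposes (members C) (length C ·ⁿ 1#) z ∩ λ x → Exceeds T (proj₁ ∘ x)) →
      z ∈ choiceSum C T
    decomposition⇒∈choiceSum C T (x , D , e) with split C x (member D) T e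
    ... | r , u , s , cone , s∈ , val , wt = assemble C T
      -- The weights sum to `n`, so cancelling `n` in `wt` identifies `r` with `unchosen C T`.
      (cone-resp (+-cancelʳ-≈ _ (trans wt (trans (+-comm _ _) (+-congˡ (weight D))))) (λ _ → refl) cone)
      s∈ (λ j → trans (sym (value D j)) (val j))

    module _ (C : List (Face P)) (hull : ∀ {y} → y ∈ P.set → ∃ (Decomposes (members C) 1# y)) where

      -- A suffix D of C is described by the embedding σ of its positions.
      ∈choiceSum⇒decomposition′ : ∀ D (σ : Fin (length D) → Fin (length C)) →
        (∀ i → Face.set (lookup D i) ⊆ Face.set (lookup C (σ i))) → ∀ T {z} → z ∈ choiceSum D T →
        ∃ λ x → Decomposes (members C) (length D ·ⁿ 1#) z x × Exceeds T (proj₁ ∘ x ∘ σ)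
      ∈choiceSum⇒decomposition′ [] σ D⊆C [] z≋0 =
        _ , decomposes-resp _ refl (λ j → sym (z≋0 j)) (decomposes-zero (members C)) , tt
      ∈choiceSum⇒decomposition′ (F ∷ D) σ D⊆C (false ∷ T) (y , z′ , y∈P , z′∈ , z≋y+z′) =
        -- The decomposition of `y` may put weight on every face of `C`, which is why `x` is indexed
        -- by `C` and not by the suffix `D`.
        let _ , E = hull y∈P
            _ , E′ , e = ∈choiceSum⇒decomposition′ D (σ ∘ suc) (D⊆C ∘ suc) T z′∈
            _ , E″ , _ , x′≤x″ = decomposes-+ _ E E′
        in _ , decomposes-resp _ refl (λ j → sym (z≋y+z′ j)) E″ , Exceeds-mono T (x′≤x″ ∘ σ ∘ suc) e
      ∈choiceSum⇒decomposition′ (F ∷ D) σ D⊆C (true ∷ T) (y , z′ , y∈F , z′∈ , z≋y+z′) =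
        -- All of `y` goes to the place of `F` itself, giving that place the weight 1 that `Exceeds`
        -- demands.
        let _ , E , t≈1 = decomposes-single (members C) (σ zero) (cone-one (D⊆C zero y∈F))
            _ , E′ , e = ∈choiceSum⇒decomposition′ D (σ ∘ suc) (D⊆C ∘ suc) T z′∈
            _ , E″ , x≤x″ , x′≤x″ = decomposes-+ _ E E′
        in _ , decomposes-resp _ refl (λ j → sym (z≋y+z′ j)) E″ ,
           ≤-respˡ t≈1 (x≤x″ (σ zero)) , Exceeds-mono T (x′≤x″ ∘ σ ∘ suc) e

      ∈choiceSum⇒decomposition : ∀ T {z} → z ∈ choiceSum C T →
        Satisfiable (Decomposes (members C) (length C ·ⁿ 1#) z ∩ λ x → Exceeds T (proj₁ ∘ x))
      ∈choiceSum⇒decomposition = ∈choiceSum⇒decomposition′ C id (λ _ → id)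

    -- K is covered by the half-spaces `tᵢ ≥ 1` because its weights sum to their number. The list is
    -- nonempty since `covering` speaks of at least one half-space.
    alternating-choiceSum : ∀ F C → (∀ {y} → y ∈ P.set → ∃ (Decomposes (members (F ∷ C)) 1# y)) → ∀ z →
      alternating (length (F ∷ C)) (λ T → z ∈ choiceSum (F ∷ C) T) ≈ 0#
    alternating-choiceSum F C hull z = trans
      (alternating-cong (length (F ∷ C)) (λ T → ∈choiceSum⇒decomposition (F ∷ C) hull T {z})
        (λ T → decomposition⇒∈choiceSum (F ∷ C) T {z}))
      (Covering.covering mix (length C) {ℓ = λ i x → proj₁ (x i)} (decomposes-convex (members (F ∷ C)))
        (λ _ _ _ _ _ → refl) (λ D → ≤-reflexive (sym (weight D))))

  -- Vertices of polytopes

  unit-nonneg : ∀ (i k : Fin n) → 0# ≤ unit i k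
  unit-nonneg zero    zero    = 0≤1
  unit-nonneg zero    (suc k) = ≤-refl
  unit-nonneg (suc i) zero    = ≤-refl
  unit-nonneg (suc i) (suc k) = unit-nonneg i k

  points⊆conv : ∀ (q : Vector (W d) n) i → q i ∈ conv q
  points⊆conv q i = unit i , unit-nonneg i ,
    trans (sum-cong-≋ (λ k → sym (*-identityʳ (unit i k)))) (·-unit i (λ _ → 1#)) ,
    λ j → sym (·-unit i (λ k → q k j))

  ∑-assoc : ∀ (c : Vector Carrier m) (e : Fin m → Fin n → Carrier) (y : Vector Carrier n) →
    sum (λ k → sum (λ i → c i * e i k) * y k) ≈ sum (λ i → c i * sum (λ k → e i k * y k))
  ∑-assoc c e y = begin
    sum (λ k → sum (λ i → c i * e i k) * y k)   ≈⟨ sum-cong-≋ (λ k → *-distribʳ-sum (y k) (λ i → c i * e i k)) ⟩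
    sum (λ k → sum (λ i → c i * e i k * y k))   ≈⟨ ∑-comm (λ k i → c i * e i k * y k) ⟩
    sum (λ i → sum (λ k → c i * e i k * y k))   ≈⟨ sum-cong-≋ (λ i → trans
      (sum-cong-≋ (λ k → *-assoc (c i) (e i k) (y k))) (sym (*-distribˡ-sum (c i) (λ k → e i k * y k)))) ⟩
    sum (λ i → c i * sum (λ k → e i k * y k))   ∎

  conv-⊆ : ∀ {p : Vector (W d) m} {q : Vector (W d) n} → (∀ i → p i ∈ conv q) → conv p ⊆ conv q
  conv-⊆ {p = p} {q} p∈q {x} (c , 0≤c , Σc≈1 , x≋cp) = (λ k → sum (λ i → c i * e i k)) ,
    (λ k → sum-nonneg (λ i → *-nonneg (0≤c i) (proj₁ (proj₂ (p∈q i)) k))) ,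
    (begin
      sum (λ k → sum (λ i → c i * e i k))        ≈⟨ sum-cong-≋ (λ k → *-identityʳ (sum (λ i → c i * e i k))) ⟨
      sum (λ k → sum (λ i → c i * e i k) * 1#)   ≈⟨ ∑-assoc c e (λ _ → 1#) ⟩
      sum (λ i → c i * sum (λ k → e i k * 1#))   ≈⟨ sum-cong-≋ (λ i → trans (*-congˡ (trans
        (sum-cong-≋ (λ k → *-identityʳ (e i k))) (proj₁ (proj₂ (proj₂ (p∈q i)))))) (*-identityʳ (c i))) ⟩
      sum c                                      ≈⟨ Σc≈1 ⟩
      1#                                         ∎) ,
    λ j → begin
      x j                                              ≈⟨ x≋cp j ⟩
      sum (λ i → c i * p i j)                          ≈⟨ sum-cong-≋ (λ i → *-congˡ (proj₂ (proj₂ (proj₂ (p∈q i))) j)) ⟩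
      sum (λ i → c i * sum (λ k → e i k * q k j))      ≈⟨ ∑-assoc c e (λ k → q k j) ⟨
      sum (λ k → sum (λ i → c i * e i k) * q k j)      ∎
    where
    e : Fin _ → Fin _ → Carrier
    e i = proj₁ (p∈q i)

  -- The other points are told apart by index, so a repeated point is never exposed.
  Exposed : Vector (W d) n → Fin n → Set
  Exposed q i = ∃₂ λ a b → (∀ k → i ≢ k → a · q k ≤ b) × ¬ (a · q i ≤ b)

  removeAt-punchOut : ∀ (q : Vector (W d) (suc n)) {i k} → i ≢ k → q k ∈ conv (removeAt q i)
  removeAt-punchOut q i≢k = subst (λ l → q l ∈ conv (removeAt q _)) (punchIn-punchOut i≢k)
    (points⊆conv (removeAt q _) (punchOut i≢k))

  -- The hull of the other points is a finite intersection of half-spaces; one that `q i` violates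
  -- separates it from them.
  exposed : ∀ (q : Vector (W d) (suc n)) i → ¬ (q i ∈ conv (removeAt q i)) → Exposed q i
  exposed q i q∉ =
    let hs , ⊆hs , hs⊆ = conv-polyhedron (removeAt q i)
        violated = All.¬All⇒Any¬ (λ _ → lem) hs (q∉ ∘ hs⊆)
        a , b = Any.lookup violated
    in a , b ,
       (λ k i≢k → proj₁ (All.lookupAny (⊆hs (removeAt-punchOut q i≢k)) violated)) ,
       Any.lookup-result violated

  -- Points in the hull of the others are discarded one by one until none is left.
  exposedGenerators : ∀ n (p : Vector (W d) n) →
    ∃₂ λ m (q : Vector (W d) m) → conv p ≐ conv q × (∀ i → Exposed q i)
  exposedGenerators zero    p = zero , p , (id , id) , λ ()
  exposedGenerators (suc n) p with any? (λ i → lem {P = p i ∈ conv (removeAt p i)})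
  ... | no all∉ = suc n , p , (id , id) , λ i → exposed p i (λ p∈ → all∉ (i , p∈))
  ... | yes (i , pᵢ∈) =
    let m , q , (rest⊆q , q⊆rest) , e = exposedGenerators n (removeAt p i)
    in m , q , (rest⊆q ∘ conv-⊆ redundant , conv-⊆ {q = p} (λ k → points⊆conv p (punchIn i k)) ∘ q⊆rest) , e
    where
    redundant : ∀ k → p k ∈ conv (removeAt p i)
    redundant k with i ≟ k
    ... | yes ≡.refl = pᵢ∈
    ... | no i≢k     = removeAt-punchOut p i≢k

  ·-combination : ∀ (a : W d) (c : Vector Carrier n) q → a · combination c q ≈ sum (λ k → c k * (a · q k))
  ·-combination a c q = begin
    sum (λ j → a j * sum (λ k → c k * q k j))   ≈⟨ sum-cong-≋ (λ j → *-comm (a j) _) ⟩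
    sum (λ j → sum (λ k → c k * q k j) * a j)   ≈⟨ ∑-assoc c q a ⟩
    sum (λ k → c k * sum (λ j → q k j * a j))   ≈⟨ sum-cong-≋ (λ k → *-congˡ (sum-cong-≋ (λ j → *-comm (q k j) (a j)))) ⟩
    sum (λ k → c k * (a · q k))                 ∎

  sum-mono : ∀ {f g : Vector Carrier n} → (∀ i → f i ≤ g i) → sum f ≤ sum g
  sum-mono {zero}  p = ≤-refl
  sum-mono {suc n} p = +-mono-≤ (p zero) (sum-mono (p ∘ suc))

  sum-nonneg-≈0 : ∀ {f : Vector Carrier n} → (∀ i → 0# ≤ f i) → sum f ≈ 0# → ∀ i → f i ≈ 0#
  sum-nonneg-≈0 p e zero    = +-nonneg-≈0ˡ (p zero) (sum-nonneg (p ∘ suc)) e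
  sum-nonneg-≈0 p e (suc i) = sum-nonneg-≈0 (p ∘ suc)
    (+-nonneg-≈0ˡ (sum-nonneg (p ∘ suc)) (p zero) (trans (+-comm _ _) e)) i

  *-cancelʳ-≈0 : ∀ {x y} → ¬ (y ≈ 0#) → x * y ≈ 0# → x ≈ 0#
  *-cancelʳ-≈0 {x} {y} y≉0 xy≈0 = let z , yz≈1 = inverse y y≉0 in begin
    x             ≈⟨ *-identityʳ x ⟨
    x * 1#        ≈⟨ *-congˡ yz≈1 ⟨
    x * (y * z)   ≈⟨ *-assoc x y z ⟨
    x * y * z     ≈⟨ *-congʳ xy≈0 ⟩
    0# * z        ≈⟨ zeroˡ z ⟩
    0#            ∎

  weightedAverage : ∀ (c : Vector Carrier n) → sum c ≈ 1# → ∀ y → sum (λ k → c k * y) ≈ y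
  weightedAverage c Σc≈1 y = trans (sym (*-distribʳ-sum y c)) (trans (*-congʳ Σc≈1) (*-identityˡ y))

  -- Among the generators `a` is maximal at index `i` only, so a convex combination attaining the
  -- maximum has no weight elsewhere.
  exposed⇒vertex : ∀ (q : Vector (W d) n) i → Exposed q i → IsVertex (conv q) (q i)
  exposed⇒vertex q i (a , b , others≤b , qᵢ≰b) = (q i , λ _ → refl) , a , a · q i , bound ,
    (λ {x} x≋qᵢ → respects (conv-polyhedron q) (λ j → sym (x≋qᵢ j)) (points⊆conv q i) , ·-congˡ a x≋qᵢ) ,
    (λ {x} ((c , 0≤c , Σc≈1 , x≋cq) , ax≈aqᵢ) j →
      trans (x≋cq j) (trans (sum-cong-≋ (λ k → concentrated c 0≤c Σc≈1
        (trans (sym (·-value c x≋cq)) ax≈aqᵢ) k j)) (weightedAverage c Σc≈1 (q i j))))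
    where
    b≤aqᵢ : b ≤ a · q i
    b≤aqᵢ with total b (a · q i)
    ... | inj₁ p = p
    ... | inj₂ p = contradiction p qᵢ≰b
    aqₖ≤aqᵢ : ∀ k → a · q k ≤ a · q i
    aqₖ≤aqᵢ k with i ≟ k
    ... | yes ≡.refl = ≤-refl
    ... | no i≢k     = ≤-trans (others≤b k i≢k) b≤aqᵢ
    ·-value : ∀ c {x} → x ≋ combination c q → a · x ≈ sum (λ k → c k * (a · q k))
    ·-value c x≋cq = trans (·-congˡ a x≋cq) (·-combination a c q)
    bound : ∀ {x} → x ∈ conv q → a · x ≤ a · q i
    bound (c , 0≤c , Σc≈1 , x≋cq) = ≤-resp (sym (·-value c x≋cq)) (weightedAverage c Σc≈1 (a · q i))
      (sum-mono (λ k → *-monoˡ-≤ (0≤c k) (aqₖ≤aqᵢ k)))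
    -- The nonnegative terms `cₖ (a · qᵢ - a · qₖ)` sum to zero, so each vanishes, and for `k ≢ i`
    -- the gap is nonzero and `cₖ ≈ 0`.
    concentrated : ∀ c → (∀ k → 0# ≤ c k) → sum c ≈ 1# → sum (λ k → c k * (a · q k)) ≈ a · q i →
      ∀ k j → c k * q k j ≈ c k * q i j
    concentrated c 0≤c Σc≈1 Σ≈ k j with i ≟ k
    ... | yes ≡.refl = refl
    ... | no i≢k     = trans (vanish _) (sym (vanish _))
      where
      gap : Fin _ → Carrier
      gap k = a · q i + - (a · q k)
      Σgap≈0 : sum (λ k → c k * gap k) ≈ 0#
      Σgap≈0 = +-cancelʳ-≈ (a · q i) (begin
        sum (λ k → c k * gap k) + a · q i                         ≈⟨ +-congˡ Σ≈ ⟨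
        sum (λ k → c k * gap k) + sum (λ k → c k * (a · q k))     ≈⟨ ∑-distrib-+ (λ k → c k * gap k) (λ k → c k * (a · q k)) ⟨
        sum (λ k → c k * gap k + c k * (a · q k))                 ≈⟨ sum-cong-≋ (λ k →
          trans (sym (distribˡ (c k) (gap k) (a · q k))) (*-congˡ (cancel′ (a · q i) (a · q k)))) ⟩
        sum (λ k → c k * (a · q i))                               ≈⟨ weightedAverage c Σc≈1 (a · q i) ⟩
        a · q i                                                   ≈⟨ +-identityˡ _ ⟨
        0# + a · q i                                              ∎)
      gap≉0 : ¬ (gap k ≈ 0#)
      gap≉0 e = qᵢ≰b (≤-respˡ (sym (x-y≈0⇒x≈y e)) (others≤b k i≢k))
      cₖ≈0 : c k ≈ 0#
      cₖ≈0 = *-cancelʳ-≈0 gap≉0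
        (sum-nonneg-≈0 (λ k → *-nonneg (0≤c k) (diff (aqₖ≤aqᵢ k))) Σgap≈0 k)
      vanish : ∀ y → c k * y ≈ 0#
      vanish y = trans (*-congʳ cₖ≈0) (zeroˡ y)

  vertex-resp : ∀ {S S′ : Subset d} {v} → S ≐ S′ → IsVertex S v → IsVertex S′ v
  vertex-resp (S⊆S′ , S′⊆S) (v∈ , a , b , bound , ⊆S , S⊆) =
    v∈ , a , b , bound ∘ S′⊆S , Product.map₁ S⊆S′ ∘ ⊆S , S⊆ ∘ Product.map₁ S′⊆S

  -- Turns a covering of the vertices into decompositions of all points of `P`.
  vertexHull : (P : Polytope k d) → ∃₂ λ m (q : Vector (W d) m) →
    Polytope.set P ⊆ conv q × (∀ i → IsVertex (Polytope.set P) (q i))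
  vertexHull P =
    let m , q , (p⊆q , q⊆p) , e = exposedGenerators P.size P.points
    in m , q , p⊆q ∘ proj₁ P.set≐conv , λ i → vertex-resp
      (proj₂ P.set≐conv ∘ q⊆p , p⊆q ∘ proj₁ P.set≐conv) (exposed⇒vertex q i (e i))
    where
    module P = Polytope P

  -- Values of the product

  real-scale-Re : ∀ {r s ρ} → r ≈ ρ → s ≈ 0# → ∀ (e : ℂ) → proj₁ ((r , s) ℂ.* e) ≈ ρ * proj₁ e
  real-scale-Re {r} {s} {ρ} r≈ρ s≈0 (x , y) = begin
    r * x + - (s * y)   ≈⟨ +-cong (*-congʳ r≈ρ) (-‿cong (trans (*-congʳ s≈0) (zeroˡ y))) ⟩
    ρ * x + - 0#        ≈⟨ +-congˡ -0#≈0# ⟩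
    ρ * x + 0#          ≈⟨ +-identityʳ _ ⟩
    ρ * x               ∎

  real-scale-Im : ∀ {r s ρ} → r ≈ ρ → s ≈ 0# → ∀ (e : ℂ) → proj₂ ((r , s) ℂ.* e) ≈ ρ * proj₂ e
  real-scale-Im {r} {s} {ρ} r≈ρ s≈0 (x , y) = begin
    r * y + s * x   ≈⟨ +-cong (*-congʳ r≈ρ) (trans (*-congʳ s≈0) (zeroˡ x)) ⟩
    ρ * y + 0#      ≈⟨ +-identityʳ _ ⟩
    ρ * y           ∎

  -- The coefficient that _-_ attaches to the subtracted indicator.
  -1ℂ : ℂ
  -1ℂ = (ℂ.- ℂ.1#) ℂ.* ℂ.1#

  -1ℂ-Re : proj₁ -1ℂ ≈ - 1#
  -1ℂ-Re = trans (real-scale-Re refl -0#≈0# ℂ.1#) (*-identityʳ _)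

  -1ℂ-Im : proj₂ -1ℂ ≈ 0#
  -1ℂ-Im = trans (real-scale-Im refl -0#≈0# ℂ.1#) (zeroʳ _)

  -- The list representing `[ wholeFace P ] - [ F ]`. It is fixed up to `≡`, as `_*ᴹ_` computes on
  -- representing lists.
  IsFactor : (P : Polytope k d) → (Face P → MinkowskiFaceRing.Carrier P) → Set₁
  IsFactor P g = ∀ F → proj₁ (g F) ≡ (ℂ.1# , facePolyhedron (wholeFace P)) ∷ (-1ℂ , facePolyhedron F) ∷ []

  module _ (π : ℂ → Carrier) where

    -- For `Q = (z ∈_)` and `π` the real or imaginary part, this is that part of the value at `z`.
    -- Arbitrary `Q` are allowed because multiplying by `[ A ]ᴹ` replaces `Q S` by `Q (A ⊕ S)`.
    total-χ : (Subset d → Set) → M d → Carrier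
    total-χ Q = List.foldr (λ (c , A) s → π c * χ (Q (NP.set A)) + s) 0#

    total-χ-++ : ∀ (Q : Subset d → Set) f g → total-χ Q (f ++ g) ≈ total-χ Q f + total-χ Q g
    total-χ-++ Q []            g = sym (+-identityˡ _)
    total-χ-++ Q ((c , A) ∷ f) g = trans (+-congˡ (total-χ-++ Q f g)) (sym (+-assoc _ _ _))

    total-χ-scale : ∀ (Q : Subset d → Set) {c ρ} A → (∀ e → π (c ℂ.* e) ≈ ρ * π e) → ∀ f →
      total-χ Q (map (λ (e , B) → c ℂ.* e , A +ᴾ B) f) ≈ ρ * total-χ (λ S → Q (NP.set A ⊕ S)) f
    total-χ-scale Q {ρ = ρ} A scales []            = sym (zeroʳ ρ)
    total-χ-scale Q {ρ = ρ} A scales ((e , B) ∷ f) = trans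
      (+-cong (trans (*-congʳ (scales e)) (*-assoc _ _ _)) (total-χ-scale Q A scales f))
      (sym (distribˡ ρ _ _))

    module _ (scale⁺ : ∀ e → π (ℂ.1# ℂ.* e) ≈ 1# * π e) (scale⁻ : ∀ e → π (-1ℂ ℂ.* e) ≈ - 1# * π e) where

      total-χ-difference : ∀ (Q : Subset d → Set) A B {g} → g ≡ (ℂ.1# , A) ∷ (-1ℂ , B) ∷ [] → ∀ f →
        total-χ Q (g *ᴹ f) ≈
        total-χ (λ S → Q (NP.set A ⊕ S)) f + - total-χ (λ S → Q (NP.set B ⊕ S)) f
      total-χ-difference Q A B ≡.refl f = begin
        total-χ Q (f₁ ++ (f₂ ++ []))          ≈⟨ total-χ-++ Q f₁ (f₂ ++ []) ⟩
        total-χ Q f₁ + total-χ Q (f₂ ++ [])   ≈⟨ +-congˡ (trans (total-χ-++ Q f₂ []) (+-identityʳ _)) ⟩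
        total-χ Q f₁ + total-χ Q f₂           ≈⟨ +-cong (total-χ-scale Q A scale⁺ f) (total-χ-scale Q B scale⁻ f) ⟩
        1# * x + - 1# * y                     ≈⟨ +-cong (*-identityˡ x) (-1*x≈-x y) ⟩
        x + - y                               ∎
        where
        f₁ = map (λ (e , C) → ℂ.1# ℂ.* e , A +ᴾ C) f
        f₂ = map (λ (e , C) → -1ℂ ℂ.* e , B +ᴾ C) f
        x = total-χ (λ S → Q (NP.set A ⊕ S)) f
        y = total-χ (λ S → Q (NP.set B ⊕ S)) f

      module _ (P : Polytope k d) {g} (isFactor : IsFactor P g) where
        open MinkowskiFaceRing P using (∏)
        open Choices P

        -- The induction changes `Q` at every factor. The scalar `π ℂ.1#` is 1 for the real part and
        -- 0 for the imaginary part.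
        total-χ-∏ : ∀ C (Q : Subset d → Set) →
          total-χ Q (proj₁ (∏ (map g C))) ≈ π ℂ.1# * alternating (length C) (λ T → Q (choiceSum C T))
        total-χ-∏ []      Q = +-identityʳ (π ℂ.1# * χ (Q ｛ 0ᵛ ｝))
        total-χ-∏ (F ∷ C) Q = begin
          total-χ Q (proj₁ (g F) *ᴹ f)
            ≈⟨ total-χ-difference Q _ _ (isFactor F) f ⟩
          total-χ (λ S → Q (Polytope.set P ⊕ S)) f + - total-χ (λ S → Q (Face.set F ⊕ S)) f
            ≈⟨ +-cong (total-χ-∏ C (λ S → Q (Polytope.set P ⊕ S))) (-‿cong (total-χ-∏ C (λ S → Q (Face.set F ⊕ S)))) ⟩
          π ℂ.1# * x + - (π ℂ.1# * y)  ≈⟨ +-congˡ (-‿distribʳ-* (π ℂ.1#) y) ⟩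
          π ℂ.1# * x + π ℂ.1# * - y    ≈⟨ distribˡ (π ℂ.1#) x (- y) ⟨
          π ℂ.1# * (x + - y)           ∎
          where
          f = proj₁ (∏ (map g C))
          x = alternating (length C) (λ T → Q (Polytope.set P ⊕ choiceSum C T))
          y = alternating (length C) (λ T → Q (Face.set F ⊕ choiceSum C T))

  indicator-χ : ∀ (S : Subset d) x → indicator S x ℂ.≈ (χ (x ∈ S) , 0#)
  indicator-χ S x with lem {P = x ∈ S}
  ... | yes _ = refl , refl
  ... | no  _ = refl , refl

  ⟦⟧-total-χ : ∀ (f : M d) z → ⟦ f ⟧ z ℂ.≈
    (total-χ proj₁ (z ∈_) f , total-χ proj₂ (z ∈_) f)
  ⟦⟧-total-χ []                  z = refl , refl
  ⟦⟧-total-χ (((a , b) , A) ∷ f) z =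
    +-cong (trans (+-cong (*-congˡ i₁) (trans (-‿cong (trans (*-congˡ i₂) (zeroʳ b))) -0#≈0#)) (+-identityʳ _))
      (proj₁ (⟦⟧-total-χ f z)) ,
    +-cong (trans (+-cong (trans (*-congˡ i₂) (zeroʳ a)) (*-congˡ i₁)) (+-identityˡ _))
      (proj₂ (⟦⟧-total-χ f z))
    where
    i₁ = proj₁ (indicator-χ (NP.set A) z)
    i₂ = proj₂ (indicator-χ (NP.set A) z)

  -- Covered vertices and vanishing of the product

  module _ (P : Polytope k d) where
    open MinkowskiFaceRing P using (∏) renaming (_≈_ to _≈ᴿ_; 0# to 0ᴿ)
    open Choices P
    private module P = Polytope P

    ⟦∏⟧ : ∀ {g} → IsFactor P g → ∀ C z →
      ⟦ proj₁ (∏ (map g C)) ⟧ z ℂ.≈ (alternating (length C) (λ T → z ∈ choiceSum C T) , 0#)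
    ⟦∏⟧ {g} isFactor C z =
      trans (proj₁ (⟦⟧-total-χ f z)) (trans
        (total-χ-∏ proj₁ (real-scale-Re refl refl) (real-scale-Re -1ℂ-Re -1ℂ-Im) P isFactor C (z ∈_)) (*-identityˡ _)) ,
      trans (proj₂ (⟦⟧-total-χ f z)) (trans
        (total-χ-∏ proj₂ (real-scale-Im refl refl) (real-scale-Im -1ℂ-Re -1ℂ-Im) P isFactor C (z ∈_)) (zeroˡ _))
      where
      f = proj₁ (∏ (map g C))

    hull⇒alternating≈0 : ∀ C {m} (q : Vector (W d) m) → P.set ⊆ conv q →
      (∀ k → ∃ λ i → q k ∈ Face.set (lookup C i)) → ∀ z →
      alternating (length C) (λ T → z ∈ choiceSum C T) ≈ 0#
    hull⇒alternating≈0 C       {zero}  q P⊆q covered z =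
      -- Without generators the coefficients of a point of `P` would have the empty sum 0 instead of
      -- 1.
      contradiction (proj₁ (proj₂ (proj₂ (P⊆q (proj₂ P.nonempty))))) 0≉1
    hull⇒alternating≈0 []      {suc m} q P⊆q covered z with () ← proj₁ (covered zero)
    hull⇒alternating≈0 (F ∷ C) {suc m} q P⊆q covered z = alternating-choiceSum F C hull z
      where
      hull : ∀ {y} → y ∈ P.set → ∃ (Decomposes (members (F ∷ C)) 1# y)
      hull y∈P =
        let c , 0≤c , Σc≈1 , y≋cq = P⊆q y∈P
            x , D = decomposes-combination (members (F ∷ C)) c q 0≤c covered
        in x , decomposes-resp (members (F ∷ C)) Σc≈1 (λ j → sym (y≋cq j)) D

    covered⇒alternating≈0 : ∀ C → (∀ v → IsVertex P.set v → ∃ λ i → v ∈ Face.set (lookup C i)) → ∀ z →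
      alternating (length C) (λ T → z ∈ choiceSum C T) ≈ 0#
    covered⇒alternating≈0 C covered =
      let _ , q , P⊆q , vertex = vertexHull P in hull⇒alternating≈0 C q P⊆q (λ k → covered (q k) (vertex k))

    module _ {v} (isVertex : IsVertex P.set v) where
      private
        a = proj₁ (proj₂ isVertex)
        b = proj₁ (proj₂ (proj₂ isVertex))
        bound : ∀ {x} → x ∈ P.set → a · x ≤ b
        bound = proj₁ (proj₂ (proj₂ (proj₂ isVertex)))
        av≈b : a · v ≈ b
        av≈b = proj₂ (proj₁ (proj₂ (proj₂ (proj₂ (proj₂ isVertex)))) (λ _ → refl))
        maximiser : ∀ {x} → x ∈ P.set → a · x ≈ b → x ≋ v
        maximiser x∈P e = proj₂ (proj₂ (proj₂ (proj₂ (proj₂ isVertex)))) (x∈P , e)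

        ·-0ᵛ : a · 0ᵛ ≈ 0#
        ·-0ᵛ = trans (sum-cong-≋ (λ i → *-comm (a i) 0#)) (·-zero a)

      multiple : ℕ → W d
      multiple zero    = 0ᵛ
      multiple (suc n) = v +ᵛ multiple n

      ·-multiple : ∀ n → a · multiple n ≈ n ·ⁿ b
      ·-multiple zero    = ·-0ᵛ
      ·-multiple (suc n) = trans (·-distribˡ a v (multiple n)) (+-cong av≈b (·-multiple n))

      ⊕-bound : ∀ {x y z β} → x ∈ P.set → a · y ≤ β → z ≋ x +ᵛ y → a · z ≤ b + β
      ⊕-bound {x} {y} x∈P ay≤β z≋x+y = ≤-respˡ (sym (trans (·-congˡ a z≋x+y) (·-distribˡ a x y)))
        (+-mono-≤ (bound x∈P) ay≤β)

      -- Every summand lies in `P` and contributes at most `b`.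
      choiceSum-bound : ∀ C T {z} → z ∈ choiceSum C T → a · z ≤ length C ·ⁿ b
      choiceSum-bound []      []      z≋0 = ≤-reflexive (trans (·-congˡ a z≋0) ·-0ᵛ)
      choiceSum-bound (F ∷ C) (true ∷ T)  (x , y , x∈ , y∈ , z≋x+y) = ⊕-bound (face-⊆ F x∈) (choiceSum-bound C T y∈) z≋x+y
      choiceSum-bound (F ∷ C) (false ∷ T) (x , y , x∈ , y∈ , z≋x+y) = ⊕-bound x∈ (choiceSum-bound C T y∈) z≋x+y

      -- v maximises the functional a on P, so nv is only the sum of n copies of v.
      peel : ∀ C T {x y} → x ∈ P.set → y ∈ choiceSum C T → multiple (suc (length C)) ≋ x +ᵛ y →
             x ≋ v × multiple (length C) ≋ y
      peel C T {x} {y} x∈P y∈ e = x≋v , λ j → +-cancelʳ-≈ (v j) (begin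
        multiple (length C) j + v j   ≈⟨ +-comm _ _ ⟩
        v j + multiple (length C) j   ≈⟨ e j ⟩
        x j + y j                     ≈⟨ +-congʳ (x≋v j) ⟩
        v j + y j                     ≈⟨ +-comm _ _ ⟩
        y j + v j                     ∎)
        where
        β = length C ·ⁿ b
        -- The functional takes the value `b + β` on the whole sum and at most `β` on `y`, so `x`
        -- attains the maximum `b`.
        b≤ax : b ≤ a · x
        b≤ax = +-cancelʳ-≤ β (≤-respˡ
          (trans (sym (trans (·-congˡ a e) (·-distribˡ a x y))) (·-multiple (suc (length C))))
          (+-mono-≤ ≤-refl (choiceSum-bound C T y∈)))
        x≋v = maximiser x∈P (antisym (bound x∈P) b≤ax)

      -- By `peel` the first summand must be `v`. The terms choosing `F` vanish as `v ∉ F`, the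
      -- others pass to one copy of `v` fewer, down to `0ᵛ ∈ ｛ 0ᵛ ｝`.
      uncovered⇒alternating≈1 : ∀ C → (∀ i → ¬ (v ∈ Face.set (lookup C i))) →
        alternating (length C) (λ T → multiple (length C) ∈ choiceSum C T) ≈ 1#
      uncovered⇒alternating≈1 []      _ = χ-true (λ _ → refl)
      uncovered⇒alternating≈1 (F ∷ C) v∉ = begin
        alternating N (λ T → z ∈ P.set ⊕ choiceSum C T) +
          - alternating N (λ T → z ∈ Face.set F ⊕ choiceSum C T)
          ≈⟨ +-cong
               (alternating-cong N
                 (λ T (x , y , x∈P , y∈ , e) → choiceSum-resp C T
                   (λ j → sym (proj₂ (peel C T x∈P y∈ e) j)) y∈)
                 (λ T nv∈ → v , multiple N , v∈P , nv∈ , λ _ → refl))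
               (-‿cong (alternating-empty N (λ T (x , y , x∈F , y∈ , e) →
                 v∉ zero (respects (face-polyhedron F) (proj₁ (peel C T (face-⊆ F x∈F) y∈ e)) x∈F)))) ⟩
        alternating N (λ T → multiple N ∈ choiceSum C T) + - 0#
          ≈⟨ +-cong (uncovered⇒alternating≈1 C (v∉ ∘ suc)) -0#≈0# ⟩
        1# + 0#  ≈⟨ +-identityʳ 1# ⟩
        1#       ∎
        where
        N = length C
        z = multiple (suc N)
        v∈P = proj₁ (proj₁ (proj₂ (proj₂ (proj₂ (proj₂ isVertex)))) (λ _ → refl))

    ∏≈0⇔covered : ∀ g → IsFactor P g → ∀ C →
      (∏ (map g C) ≈ᴿ 0ᴿ) ⇔ (∀ v → IsVertex P.set v → Any (λ F → v ∈ Face.set F) C)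
    ∏≈0⇔covered g isFactor C = mk⇔ to from
      where
      to : ∏ (map g C) ≈ᴿ 0ᴿ → ∀ v → IsVertex P.set v → Any (λ F → v ∈ Face.set F) C
      to e v isVertex with lem {P = Any (λ F → v ∈ Face.set F) C}
      ... | yes v∈ = v∈
      -- At `nv` the product would be 0 by assumption and 1 because `v` is uncovered.
      ... | no v∉ = contradiction
        (trans (sym (proj₁ (e z))) (trans (proj₁ (⟦∏⟧ isFactor C z))
          (uncovered⇒alternating≈1 isVertex C (λ i v∈ → v∉ (lose (∈-lookup i) v∈)))))
        0≉1
        where z = multiple isVertex (length C)
      from : (∀ v → IsVertex P.set v → Any (λ F → v ∈ Face.set F) C) → ∏ (map g C) ≈ᴿ 0ᴿ
      from covered z = trans (proj₁ (⟦∏⟧ isFactor C z)) (covered⇒alternating≈0 C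
        (λ v isVertex → Any.index (covered v isVertex) , Any.lookup-index (covered v isVertex)) z) ,
        proj₂ (⟦∏⟧ isFactor C z)

proposition4p16 : (lem : ∀ {ℓ} → ExcludedMiddle ℓ) (ℝ : CompleteOrderedField) →
    let open ConvexGeometry lem ℝ in
    (d : ℕ) (P : Polytope d d) (C : List (Face P)) → UniqueFaces P C →
    let open MinkowskiFaceRing P in
    (∏ (map (λ F → [ wholeFace P ] - [ F ]) C) ≈ 0#) ⇔
    (∀ v → IsVertex (Polytope.set P) v → Any (λ F → v ∈ Face.set F) C)
proposition4p16 lem ℝ d P C _ = MinkowskiIdentity.∏≈0⇔covered lem ℝ P (λ F → [ wholeFace P ] - [ F ]) (λ _ → ≡.refl) C
  where
  open ConvexGeometry lem ℝ
  open MinkowskiFaceRing P
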